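{- Fix $n\ge2$ and let $X^{(n)}_1,X^{(n)}_2,\dots$ be independent random variables uniformly distributed on $\{1,\dots,n\}$. Let $\mathcal{T}_n$ be the least $m\ge1$ such that $\operatorname{lcm}(X^{(n)}_1,\dots,X^{(n)}_m)=\operatorname{lcm}(1,2,\dots,n)$. Then $$n\,H_{\omega_1(n)}\le\mathbb{E}(\mathcal{T}_n)\le n\,H_{\omega_1(n)}+n\,\frac{\pi(n)-\omega_1(n)}{\omega_1(n)^2}.$$
   Context: $H_k=\sum_{j=1}^k 1/j$ is the $k$-th harmonic number. $\pi(n)$ is the number of primes $\le n$. For a prime $p\le n$, $\gamma_p(n)=\lfloor\ln n/\ln p\rfloor$ and $\beta_p(n)=\lfloor n/p^{\gamma_p(n)}\rfloor$; $\omega_1(n)$ is the number of primes $p\le n$ with $\beta_p(n)=1$. -}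

module Defs where

open import Data.Nat as ℕ using (ℕ; zero; suc; _^_; _∸_; NonZero)
open import Data.Nat.Properties using (_≤?_; _≟_; m^n≢0; m*n≢0)
open import Data.Nat.DivMod using () renaming (_/_ to _div_)
open import Data.Nat.LCM using (lcm)
open import Data.Nat.Primality using (prime?)
open import Data.Integer using (+_)
open import Data.Rational using (ℚ; 0ℚ; _+_; _*_; _/_)
open import Data.List using (List; []; _∷_; map; foldr; upTo; concatMap; filter; length; take)
open import Data.Bool using (if_then_else_)
open import Relation.Nullary using (does; ¬?)
open import Relation.Nullary.Decidable using (_×-dec_)

lcmList : List ℕ → ℕ
lcmList = foldr lcm 1

lcmUpTo : ℕ → ℕ
lcmUpTo n = lcmList (map suc (upTo n))

oneTo : ℕ → List ℕ
oneTo n = map suc (upTo n)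

seqs : ℕ → ℕ → List (List ℕ)
seqs n zero    = [] ∷ []
seqs n (suc k) = concatMap (λ x → map (x ∷_) (seqs n k)) (oneTo n)

-- number of sequences in {1..n}^k for which T_n = k, i.e.
-- lcm(x₁..x_k) = lcm(1..n) but lcm(x₁..x_{k-1}) ≠ lcm(1..n)
countT : ℕ → ℕ → ℕ
countT n k = length (filter (λ xs → (lcmList xs ≟ lcmUpTo n) ×-dec ¬? (lcmList (take (k ∸ 1) xs) ≟ lcmUpTo n)) (seqs n k))

probT : ℕ → ℕ → ℚ
probT zero    k = 0ℚ
probT (suc m) k = (+ countT (suc m) k) / (suc m ^ k)
  where instance _ = m^n≢0 (suc m) k

-- partial sums  Σ_{k=1}^{N} k · P(T_n = k)  of the series defining E(T_n)
expPartial : ℕ → ℕ → ℚ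
expPartial n zero    = 0ℚ
expPartial n (suc N) = expPartial n N + (+ suc N / 1) * probT n (suc N)

-- γ_p(n) = ⌊ln n / ln p⌋ = the largest g with p^g ≤ n (for a prime p ≤ n)
gammaP : ℕ → ℕ → ℕ
gammaP p n = go n
  where
  go : ℕ → ℕ
  go zero    = zero
  go (suc g) = if does (p ^ suc g ≤? n) then suc g else go g

-- β_p(n) = ⌊n / p^{γ_p(n)}⌋  (only meaningful for p ≥ 1; primes are ≥ 2)
betaP : ℕ → ℕ → ℕ
betaP zero    n = zero
betaP (suc q) n = n div (suc q ^ gammaP (suc q) n)
  where instance _ = m^n≢0 (suc q) (gammaP (suc q) n)

primeCount : ℕ → ℕ
primeCount n = length (filter prime? (upTo (suc n)))

omega1 : ℕ → ℕ
omega1 n = length (filter (λ p → prime? p ×-dec (betaP p n ≟ 1)) (upTo (suc n)))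

harmonic : ℕ → ℚ
harmonic zero    = 0ℚ
harmonic (suc k) = harmonic k + (+ 1) / suc k

-- a / d for natural d, with the convention a / 0 = 0 (never used: ω₁(n) ≥ 1 for n ≥ 2)
_/ℕ_ : ℕ → ℕ → ℚ
a /ℕ zero    = 0ℚ
a /ℕ (suc d) = (+ a) / suc d

toℚ : ℕ → ℚ
toℚ n = (+ n) / 1

{-# OPTIONS --safe #-}

-- A list of draws has the full lcm exactly when, for every prime p ≤ n, some draw is divisible
-- by the prime part p ^ gammaP p n.  For p < q a common multiple of the two prime parts exceeds n,
-- so collecting the prime parts is a coupon collector problem in which each draw yields at most
-- one coupon and the coupon of p has probability betaP p n / n.  Call p light if betaP p n = 1 and
-- heavy otherwise.  With r light and j heavy coupons missing, one draw
--   * lowers n * harmonic r by 1 in mean while r > 0, which gives the lower bound;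
--   * lowers n * (harmonic r + j / ((r+1)(r+2))) by at least 1 in mean while r + j > 0, since heavy
--     coupons have probability at least 2/n, which gives the upper bound;
--   * lowers r + j by at least (r + j) / n in mean, so the boundary term N * P(T > N) left by
--     summation by parts vanishes.
-- The prime 2 is light, so omega1 n ≥ 1.
module Submission where

open import Defs

-- Origin of the second potential: among `r` missing coupons of weight 1 and one of weight 2, the
-- latter comes last with probability the product of i/(i+2) for i = 1..r, which is 2/((r+1)(r+2)),
-- and it then costs n/2 further draws in mean. Charging every heavy coupon separately for this
-- delay adds n * j/((r+1)(r+2)) to n * `harmonic` r. The drift inequality verifies this guess state
-- by state, so the order of arrivals never has to be described and only finite averages over ℚ
-- occur. The obstacle is that E(T) is visible only through partial sums. For the upper bound the
-- terms left over by summation by parts have the right sign. For the lower bound they must tend to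
-- 0, and the mean number of missing coupons at time N is only shown to be O(1/N), which merely
-- keeps N * P(T > N) bounded. The decay estimate is therefore applied twice, on the draws up to M
-- and again on those from M to 2M.

module PrimeParts where

  -- Prime powers, lcms and the prime parts of `n`.

  open import Data.Bool using (if_then_else_)
  open import Data.List using ([]; _∷_; map)
  open import Data.List.Membership.Propositional using (_∈_)
  open import Data.List.Membership.Propositional.Properties using (∈-map⁺; ∈-map⁻; ∈-upTo⁺; ∈-upTo⁻)
  open import Data.List.Relation.Unary.All as All using (All; []; _∷_)
  open import Data.List.Relation.Unary.Any as Any using (Any; here; there)
  open import Data.Nat using (ℕ; zero; suc; _*_; _∸_; _^_; _≤_; _<_; z≤n; s≤s; z<s; NonZero; nonTrivial⇒n>1; >-nonZero; ≢-nonZero)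
  open import Data.Nat.Coprimality using (Coprime; coprime-/gcd)
  open import Data.Nat.Divisibility
  open import Data.Nat.GCD using (gcd; gcd[m,n]∣m; gcd[m,n]∣n; gcd[m,n]≢0)
  open import Data.Nat.LCM using (lcm; m∣lcm[m,n]; n∣lcm[m,n]; lcm-least; gcd*lcm)
  open import Data.Nat.ListAction using (product)
  open import Data.Nat.Primality using (Prime; euclidsLemma; prime⇒irreducible; prime⇒nonTrivial; prime⇒nonZero; ¬prime[1])
  open import Data.Nat.Primality.Factorisation using (PrimeFactorisation; factorise)
  open import Data.Nat.Properties
  open import Data.Product using (_×_; _,_)
  open import Data.Sum using (_⊎_; inj₁; inj₂; [_,_]′)
  open import Function using (_∘_; id)
  open import Relation.Binary.Definitions using (tri<; tri≈; tri>)
  open import Relation.Binary.PropositionalEquality using (_≡_; refl; sym; trans; cong; subst; subst₂; module ≡-Reasoning)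
  open import Relation.Nullary using (¬_; Dec; yes; no; does; contradiction)

  prime>1 : ∀ {p} → Prime p → 1 < p
  prime>1 {p} pp = nonTrivial⇒n>1 p {{prime⇒nonTrivial pp}}

  prime∣prime⇒≡ : ∀ {p q} → Prime p → Prime q → p ∣ q → p ≡ q
  prime∣prime⇒≡ pp pq p∣q with prime⇒irreducible pq p∣q
  ... | inj₁ refl = contradiction pp ¬prime[1]
  ... | inj₂ p≡q = p≡q

  -- Induction on the exponent: once `n = c * p ^ a`, cancelling `p ^ a` leaves `p ∣ m * c`, and
  -- Euclid's lemma moves the last factor into `c`.
  ^-cancel-∤ : ∀ {p m} → Prime p → p ∤ m → ∀ a n → p ^ a ∣ m * n → p ^ a ∣ n
  ^-cancel-∤ pp p∤m zero n _ = 1∣ n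
  ^-cancel-∤ {p} {m} pp p∤m (suc a) n d
    with divides c refl ← ^-cancel-∤ pp p∤m a n (∣-trans (n∣m*n p) d)
    with euclidsLemma m c pp (*-cancelʳ-∣ (p ^ a) (subst (p * p ^ a ∣_) (sym (*-assoc m c (p ^ a))) d))
    where instance _ = m^n≢0 p a {{prime⇒nonZero pp}}
  ... | inj₁ p∣m = contradiction p∣m p∤m
  ... | inj₂ p∣c = *-monoˡ-∣ (p ^ a) p∣c

  -- With `g` the gcd, the lcm equals both `n′ * m` and `m′ * n`, where `m′` and `n′` are coprime.
  -- So `p` fails to divide one of these cofactors, and that one can be cancelled.
  ^-∣-lcm : ∀ {p} → Prime p → ∀ a m n → p ^ a ∣ lcm m n → p ^ a ∣ m ⊎ p ^ a ∣ n
  ^-∣-lcm pp a zero n _ = inj₁ (_ ∣0)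
  ^-∣-lcm {p} pp a m@(suc _) n d = result
    where
    g = gcd m n
    instance
      _ : NonZero g
      _ = ≢-nonZero (gcd[m,n]≢0 m n (inj₁ λ ()))
    m′ = quotient (gcd[m,n]∣m m n)
    n′ = quotient (gcd[m,n]∣n m n)
    m≡ : m ≡ m′ * g
    m≡ = m∣n⇒n≡quotient*m (gcd[m,n]∣m m n)
    n≡ : n ≡ n′ * g
    n≡ = m∣n⇒n≡quotient*m (gcd[m,n]∣n m n)
    lcm≡ : lcm m n ≡ n′ * m
    lcm≡ = *-cancelˡ-≡ (lcm m n) (n′ * m) g (begin
      g * lcm m n   ≡⟨ gcd*lcm m n ⟩
      m * n         ≡⟨ cong (m *_) n≡ ⟩
      m * (n′ * g)  ≡⟨ *-assoc m n′ g ⟨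
      m * n′ * g    ≡⟨ cong (_* g) (*-comm m n′) ⟩
      n′ * m * g    ≡⟨ *-comm (n′ * m) g ⟩
      g * (n′ * m)  ∎)
      where open ≡-Reasoning
    n′*m≡m′*n : n′ * m ≡ m′ * n
    n′*m≡m′*n = begin
      n′ * m         ≡⟨ cong (n′ *_) m≡ ⟩
      n′ * (m′ * g)  ≡⟨ *-assoc n′ m′ g ⟨
      n′ * m′ * g    ≡⟨ cong (_* g) (*-comm n′ m′) ⟩
      m′ * n′ * g    ≡⟨ *-assoc m′ n′ g ⟩
      m′ * (n′ * g)  ≡⟨ cong (m′ *_) n≡ ⟨
      m′ * n         ∎
      where open ≡-Reasoning
    coprime : Coprime m′ n′
    coprime = subst₂ Coprime (n/m≡quotient (gcd[m,n]∣m m n)) (n/m≡quotient (gcd[m,n]∣n m n)) (coprime-/gcd m n)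
    result : p ^ a ∣ m ⊎ p ^ a ∣ n
    result with p ∣? n′
    ... | no p∤n′ = inj₁ (^-cancel-∤ pp p∤n′ a m (subst (p ^ a ∣_) lcm≡ d))
    ... | yes p∣n′ = inj₂ (^-cancel-∤ pp p∤m′ a n (subst (p ^ a ∣_) (trans lcm≡ n′*m≡m′*n) d))
      where
      p∤m′ : p ∤ m′
      p∤m′ p∣m′ = ¬prime[1] (subst Prime (coprime (p∣m′ , p∣n′)) pp)

  -- Excluding `p ^ a ≡ 1` handles the empty list, whose lcm is 1.
  ^-∣-lcmList : ∀ {p} → Prime p → ∀ a xs → ¬ (p ^ a ≡ 1) → p ^ a ∣ lcmList xs → Any (p ^ a ∣_) xs
  ^-∣-lcmList pp a [] ≢1 d = contradiction (∣1⇒≡1 d) ≢1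
  ^-∣-lcmList pp a (x ∷ xs) ≢1 d with ^-∣-lcm pp a x (lcmList xs) d
  ... | inj₁ d′ = here d′
  ... | inj₂ d′ = there (^-∣-lcmList pp a xs ≢1 d′)

  ∣lcmList : ∀ {d} xs → Any (d ∣_) xs → d ∣ lcmList xs
  ∣lcmList (x ∷ xs) (here d∣x) = ∣-trans d∣x (m∣lcm[m,n] x (lcmList xs))
  ∣lcmList (x ∷ xs) (there d∈) = ∣-trans (∣lcmList xs d∈) (n∣lcm[m,n] x (lcmList xs))

  lcmList-least : ∀ {k xs} → All (_∣ k) xs → lcmList xs ∣ k
  lcmList-least [] = 1∣ _
  lcmList-least (x∣k ∷ xs∣k) = lcm-least x∣k (lcmList-least xs∣k)

  -- Induction on the prime factorisation. The head `q` divides `k` by the hypothesis at exponent 1;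
  -- for `k = k′ * q` the hypothesis passes to `k′`, using exponent `a + 1` when `p = q` and
  -- cancelling `q` otherwise.
  ∣-by-prime-powers : ∀ m .{{_ : NonZero m}} k → (∀ {p} a → Prime p → p ^ a ∣ m → p ^ a ∣ k) → m ∣ k
  ∣-by-prime-powers m k h =
    subst (_∣ k) (sym isFactorisation) (product∣ factors factorsPrime k λ {p} a pp d →
      h a pp (subst (p ^ a ∣_) (sym isFactorisation) d))
    where
    open PrimeFactorisation (factorise m)
    product∣ : ∀ ps → All Prime ps → ∀ k → (∀ {p} a → Prime p → p ^ a ∣ product ps → p ^ a ∣ k) → product ps ∣ k
    product∣ [] [] k h = 1∣ k
    product∣ (q ∷ ps) (pq ∷ pps) k h
      with divides k′ refl ← subst (_∣ k) (*-identityʳ q) (h 1 pq (subst (_∣ q * product ps) (sym (*-identityʳ q)) (m∣m*n (product ps))))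
      = subst (q * product ps ∣_) (*-comm q k′) (*-monoʳ-∣ q (product∣ ps pps k′ h′))
      where
      h′ : ∀ {p} a → Prime p → p ^ a ∣ product ps → p ^ a ∣ k′
      h′ {p} a pp d with p ≟ q
      ... | yes refl = *-cancelˡ-∣ p {{prime⇒nonZero pp}} (subst (p * p ^ a ∣_) (*-comm k′ p) (h (suc a) pp (*-monoʳ-∣ p d)))
      ... | no p≢q = ^-cancel-∤ pp (p≢q ∘ prime∣prime⇒≡ pp pq) a k′ (subst (p ^ a ∣_) (*-comm k′ q) (h a pp (∣n⇒∣m*n q d)))

  mutual
    -- The search loop local to gammaP has no name outside Defs; unification recovers it as the
    -- solution of the underscore, once the `with` has separated the bound from the loop counter.
    gammaLoop : ℕ → ℕ → ℕ → ℕ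
    gammaLoop = _

    gammaP-unfold : ∀ p m → gammaP p (suc m) ≡ (if does (p ^ suc m ≤? suc m) then suc m else gammaLoop p (suc m) m)
    gammaP-unfold p m with suc m
    ... | w = refl

  if-does-elim : ∀ {a b c} {P : Set a} {A : Set b} (C : A → Set c) (P? : Dec P) {x y : A} →
    (P → C x) → (¬ P → C y) → C (if does P? then x else y)
  if-does-elim C (yes p) cx cy = cx p
  if-does-elim C (no ¬p) cx cy = cy ¬p

  gammaLoop-≤ : ∀ p {n} → 1 ≤ n → ∀ g → p ^ gammaLoop p n g ≤ n
  gammaLoop-≤ p 1≤n zero = 1≤n
  gammaLoop-≤ p {n} 1≤n (suc g) =
    if-does-elim (λ e → p ^ e ≤ n) (p ^ suc g ≤? n) id (λ _ → gammaLoop-≤ p 1≤n g)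

  gammaLoop-max : ∀ p n g e → e ≤ g → p ^ e ≤ n → e ≤ gammaLoop p n g
  gammaLoop-max p n zero e e≤g _ = e≤g
  gammaLoop-max p n (suc g) e e≤g p^e≤n =
    if-does-elim (e ≤_) (p ^ suc g ≤? n) (λ _ → e≤g) λ ¬q →
      [ (λ e<1+g → gammaLoop-max p n g e (≤-pred e<1+g) p^e≤n)
      , (λ { refl → contradiction p^e≤n ¬q }) ]′ (m≤n⇒m<n∨m≡n e≤g)

  primePart : ℕ → ℕ → ℕ
  primePart p n = p ^ gammaP p n

  primePart≤n : ∀ p {n} → 1 ≤ n → primePart p n ≤ n
  primePart≤n p {n} 1≤n = gammaLoop-≤ p 1≤n n

  n<m^n : ∀ {m} → 1 < m → ∀ n → n < m ^ n
  n<m^n 1<m zero = z<s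
  n<m^n {m} 1<m (suc n) = ≤-<-trans (n<m^n 1<m n) (^-monoʳ-< m 1<m (n<1+n n))

  -- The downward search starts at `n`, which is high enough because `e < p ^ e ≤ n`.
  gammaP-max : ∀ {p} → 1 < p → ∀ n e → p ^ e ≤ n → e ≤ gammaP p n
  gammaP-max {p} 1<p n e p^e≤n = gammaLoop-max p n n e (≤-trans (<⇒≤ (n<m^n 1<p e)) p^e≤n) p^e≤n

  n<p*primePart : ∀ {p} → 1 < p → ∀ n → n < p * primePart p n
  n<p*primePart {p} 1<p n with p * primePart p n ≤? n
  ... | yes q = contradiction (gammaP-max 1<p n (suc (gammaP p n)) q) (<⇒≱ (n<1+n _))
  ... | no ¬q = ≰⇒> ¬q

  p∣primePart : ∀ {p n} → Prime p → p ≤ n → p ∣ primePart p n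
  p∣primePart {p} {n} pp p≤n =
    pow (gammaP p n) (gammaP-max (prime>1 pp) n 1 (subst (_≤ n) (sym (*-identityʳ p)) p≤n))
    where
    pow : ∀ e → 1 ≤ e → p ∣ p ^ e
    pow (suc e) _ = m∣m*n (p ^ e)

  primePart-disjoint-< : ∀ {p q n x} → Prime p → Prime q → p < q → q ≤ n → 1 ≤ x → x ≤ n →
    primePart p n ∣ x → primePart q n ∣ x → p ≡ q
  primePart-disjoint-< {p} {q} {n} {x} pp pq p<q q≤n 1≤x x≤n dp dq
    with divides c refl ← ∣-trans (p∣primePart pq q≤n) dq
    = contradiction (begin-strict
        n                    <⟨ n<p*primePart (prime>1 pp) n ⟩
        p * primePart p n    ≤⟨ *-monoˡ-≤ (primePart p n) (<⇒≤ p<q) ⟩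
        q * primePart p n    ≤⟨ ∣⇒≤ (subst (q * primePart p n ∣_) (*-comm q c) (*-monoʳ-∣ q d)) ⟩
        c * q                ≤⟨ x≤n ⟩
        n                    ∎) (<-irrefl refl)
    where
    open ≤-Reasoning
    instance _ = >-nonZero 1≤x
    d : primePart p n ∣ c
    d = ^-cancel-∤ pp (<⇒≢ p<q ∘ prime∣prime⇒≡ pp pq) (gammaP p n) c (subst (primePart p n ∣_) (*-comm c q) dp)

  -- For p < q, a common multiple of both prime parts is at least q * primePart p n > n.
  primePart-disjoint : ∀ {p q n x} → Prime p → Prime q → p ≤ n → q ≤ n → 1 ≤ x → x ≤ n →
    primePart p n ∣ x → primePart q n ∣ x → p ≡ q
  primePart-disjoint {p} {q} pp pq p≤n q≤n 1≤x x≤n dp dq with <-cmp p q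
  ... | tri< p<q _ _ = primePart-disjoint-< pp pq p<q q≤n 1≤x x≤n dp dq
  ... | tri≈ _ p≡q _ = p≡q
  ... | tri> _ _ q<p = sym (primePart-disjoint-< pq pp q<p p≤n 1≤x x≤n dq dp)

  ^-∣-primePart : ∀ {p n m} → Prime p → 1 ≤ m → m ≤ n → ∀ a → p ^ a ∣ m → p ^ a ∣ primePart p n
  ^-∣-primePart {p} {n} {m} pp 1≤m m≤n a d =
    subst (λ e → p ^ a ∣ p ^ e) (m+[n∸m]≡n a≤γ)
      (subst (p ^ a ∣_) (sym (^-distribˡ-+-* p a (gammaP p n ∸ a))) (m∣m*n _))
    where
    instance _ = >-nonZero 1≤m
    a≤γ : a ≤ gammaP p n
    a≤γ = gammaP-max (prime>1 pp) n a (≤-trans (∣⇒≤ d) m≤n)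

  ∈oneTo⁻ : ∀ {n x} → x ∈ oneTo n → 1 ≤ x × x ≤ n
  ∈oneTo⁻ x∈ with y , y∈ , refl ← ∈-map⁻ suc x∈ = s≤s z≤n , ∈-upTo⁻ y∈

  ∈oneTo⁺ : ∀ {n x} → 1 ≤ x → x ≤ n → x ∈ oneTo n
  ∈oneTo⁺ {x = suc x} _ x≤n = ∈-map⁺ suc (∈-upTo⁺ x≤n)

  lcmList∣lcmUpTo : ∀ {n xs} → All (λ x → 1 ≤ x × x ≤ n) xs → lcmList xs ∣ lcmUpTo n
  lcmList∣lcmUpTo {n} inRange = lcmList-least
    (All.map (λ (1≤x , x≤n) → ∣lcmList (oneTo n) (Any.map (λ { refl → ∣-refl }) (∈oneTo⁺ 1≤x x≤n))) inRange)

  -- Each `m ≤ n` is tested on its prime powers: `p ^ a ∣ m` forces `p ^ a ≤ n`, so `p ^ a` divides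
  -- the prime part of `p`, which divides some draw.
  lcmList-complete : ∀ n xs → All (λ x → 1 ≤ x × x ≤ n) xs →
    (∀ {p} → Prime p → p ≤ n → Any (primePart p n ∣_) xs) → lcmList xs ≡ lcmUpTo n
  lcmList-complete n xs inRange collected = ∣-antisym
    (lcmList∣lcmUpTo inRange)
    (lcmList-least (All.tabulate λ x∈ → divides-lcm (∈oneTo⁻ x∈)))
    where
    divides-lcm : ∀ {m} → 1 ≤ m × m ≤ n → m ∣ lcmList xs
    divides-lcm {m} (1≤m , m≤n) = ∣-by-prime-powers m (lcmList xs) λ where
        zero pp d → 1∣ _
        (suc a) pp d → ∣-trans (^-∣-primePart pp 1≤m m≤n (suc a) d)
          (∣lcmList xs (collected pp (≤-trans (∣⇒≤ (m*n∣⇒m∣ _ _ d)) m≤n)))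
      where instance _ = >-nonZero 1≤m

  -- The prime part is itself one of `1, ..., n`, hence divides the full lcm, and a prime power
  -- dividing an lcm divides an entry.
  lcmList-collected : ∀ {n xs p} → lcmList xs ≡ lcmUpTo n → Prime p → p ≤ n → Any (primePart p n ∣_) xs
  lcmList-collected {n} {xs} {p} eq pp p≤n = ^-∣-lcmList pp (gammaP p n) xs part≢1
    (subst (primePart p n ∣_) (sym eq) (∣lcmList (oneTo n)
      (Any.map (λ { refl → ∣-refl }) (∈oneTo⁺ (m^n>0 p (gammaP p n)) (primePart≤n p 1≤n)))))
    where
    instance _ = prime⇒nonZero pp
    1≤n : 1 ≤ n
    1≤n = ≤-trans (<⇒≤ (prime>1 pp)) p≤n
    part≢1 : ¬ (primePart p n ≡ 1)
    part≢1 eq = ¬prime[1] (subst Prime (∣1⇒≡1 (subst (p ∣_) eq (p∣primePart pp p≤n))) pp)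

-- Finite sums, and `betaP` as a number of multiples.

module Coupons where

  open PrimeParts
  open import Data.Bool using (if_then_else_)
  open import Data.List using (List; []; _∷_; _∷ʳ_; _++_; map; upTo; length; filter; concatMap)
  open import Data.List.Properties using (upTo-∷ʳ; map-++)
  open import Data.List.Membership.Propositional using (_∈_)
  open import Data.List.Membership.Propositional.Properties using (∈-upTo⁺; ∈-upTo⁻)
  open import Data.List.Relation.Unary.All as All using (All; []; _∷_)
  open import Data.List.Relation.Unary.AllPairs using (AllPairs; []; _∷_)
  open import Data.List.Relation.Unary.Any using (Any; here; there)
  open import Data.List.Relation.Unary.Unique.Propositional using (Unique)
  open import Data.List.Relation.Unary.Unique.Propositional.Properties using (upTo⁺)
  open import Data.Nat using (ℕ; zero; suc; _+_; _*_; _∸_; _≤_; _<_; z≤n; s≤s; NonZero; >-nonZero⁻¹)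
  open import Data.Nat.Divisibility
  open import Data.Nat.DivMod using (_/_; m/n≡0⇒m<n; m<n*o⇒m/o<n; /-monoˡ-≤; m*n/n≡m)
  open import Data.Nat.ListAction using (sum)
  open import Data.Nat.ListAction.Properties using (sum-++)
  open import Data.Nat.Primality using (Prime; prime?; ¬prime[0]; prime[2])
  open import Data.Nat.Properties
  open import Data.Nat.Solver using (module +-*-Solver)
  open import Data.Product using (_×_; _,_)
  open import Data.Sum using (_⊎_; inj₁; inj₂)
  open import Function using (_∘_)
  open import Relation.Binary.PropositionalEquality using (_≡_; _≢_; refl; sym; trans; cong; cong₂; subst; module ≡-Reasoning)
  open import Relation.Nullary using (¬_; Dec; yes; no; does; contradiction; ¬?)
  open import Relation.Nullary.Decidable using (_×-dec_)
  open import Relation.Unary using (Decidable)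
  open +-*-Solver using (solve; _:+_; _:=_)

  infix 9 ⟦_⟧
  ⟦_⟧ : ∀ {a} {P : Set a} → Dec P → ℕ
  ⟦ P? ⟧ = if does P? then 1 else 0

  ⟦⟧≤1 : ∀ {a} {P : Set a} (P? : Dec P) → ⟦ P? ⟧ ≤ 1
  ⟦⟧≤1 (yes _) = ≤-refl
  ⟦⟧≤1 (no _) = z≤n

  ⟦⟧-yes : ∀ {a} {P : Set a} (P? : Dec P) → P → ⟦ P? ⟧ ≡ 1
  ⟦⟧-yes (yes _) p = refl
  ⟦⟧-yes (no ¬p) p = contradiction p ¬p

  ⟦⟧-no : ∀ {a} {P : Set a} (P? : Dec P) → ¬ P → ⟦ P? ⟧ ≡ 0
  ⟦⟧-no (yes p) ¬p = contradiction p ¬p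
  ⟦⟧-no (no _) ¬p = refl

  ⟦⟧-split : ∀ {a b} {P : Set a} {Q : Set b} (P? : Dec P) (Q? : Dec Q) →
    ⟦ P? ×-dec Q? ⟧ + ⟦ P? ×-dec ¬? Q? ⟧ ≡ ⟦ P? ⟧
  ⟦⟧-split (yes _) (yes _) = refl
  ⟦⟧-split (yes _) (no _) = refl
  ⟦⟧-split (no _) _ = refl

  ∑ : {A : Set} → List A → (A → ℕ) → ℕ
  ∑ xs f = sum (map f xs)

  module _ {A : Set} where

    ∑-cong : ∀ {f g : A → ℕ} xs → (∀ {x} → x ∈ xs → f x ≡ g x) → ∑ xs f ≡ ∑ xs g
    ∑-cong [] _ = refl
    ∑-cong (x ∷ xs) f≡g = cong₂ _+_ (f≡g (here refl)) (∑-cong xs (f≡g ∘ there))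

    ∑-mono : ∀ {f g : A → ℕ} xs → (∀ {x} → x ∈ xs → f x ≤ g x) → ∑ xs f ≤ ∑ xs g
    ∑-mono [] _ = z≤n
    ∑-mono (x ∷ xs) f≤g = +-mono-≤ (f≤g (here refl)) (∑-mono xs (f≤g ∘ there))

    ∑-+ : ∀ (f g : A → ℕ) xs → ∑ xs (λ x → f x + g x) ≡ ∑ xs f + ∑ xs g
    ∑-+ f g [] = refl
    ∑-+ f g (x ∷ xs) rewrite ∑-+ f g xs =
      solve 4 (λ a b c d → a :+ b :+ (c :+ d) := a :+ c :+ (b :+ d)) refl (f x) (g x) (∑ xs f) (∑ xs g)

    ∑-*ˡ : ∀ c (f : A → ℕ) xs → ∑ xs (λ x → c * f x) ≡ c * ∑ xs f
    ∑-*ˡ c f [] = sym (*-zeroʳ c)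
    ∑-*ˡ c f (x ∷ xs) rewrite ∑-*ˡ c f xs = sym (*-distribˡ-+ c (f x) (∑ xs f))

    ∑-0 : ∀ (xs : List A) → ∑ xs (λ _ → 0) ≡ 0
    ∑-0 [] = refl
    ∑-0 (x ∷ xs) = ∑-0 xs

    ∑-++ : ∀ (f : A → ℕ) xs ys → ∑ (xs ++ ys) f ≡ ∑ xs f + ∑ ys f
    ∑-++ f xs ys = trans (cong sum (map-++ f xs ys)) (sum-++ (map f xs) (map f ys))

    ∑-∷ʳ : ∀ (f : A → ℕ) xs y → ∑ (xs ∷ʳ y) f ≡ ∑ xs f + f y
    ∑-∷ʳ f xs y = trans (∑-++ f xs (y ∷ [])) (cong (∑ xs f +_) (+-identityʳ (f y)))

    ∑-≡0 : ∀ {f : A → ℕ} xs → ∑ xs f ≡ 0 → ∀ {x} → x ∈ xs → f x ≡ 0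
    ∑-≡0 {f} (x ∷ xs) eq (here refl) = m+n≡0⇒m≡0 (f x) eq
    ∑-≡0 {f} (x ∷ xs) eq (there x∈) = ∑-≡0 xs (m+n≡0⇒n≡0 (f x) eq) x∈

    length-filter≡∑ : ∀ {p} {P : A → Set p} (P? : Decidable P) xs → length (filter P? xs) ≡ ∑ xs (λ x → ⟦ P? x ⟧)
    length-filter≡∑ P? [] = refl
    length-filter≡∑ P? (x ∷ xs) with P? x
    ... | yes _ = cong suc (length-filter≡∑ P? xs)
    ... | no _ = length-filter≡∑ P? xs

    ∑≤1 : ∀ {f : A → ℕ} {xs} → (∀ x → f x ≤ 1) → AllPairs (λ x y → f x ≡ 0 ⊎ f y ≡ 0) xs → ∑ xs f ≤ 1
    ∑≤1 f≤1 [] = z≤n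
    ∑≤1 {f} {x ∷ xs} f≤1 (x# ∷ xs#) with f x in fx≡
    ... | zero = ∑≤1 f≤1 xs#
    ... | suc k = begin
        suc k + ∑ xs f         ≡⟨ cong (suc k +_) (trans (∑-cong xs λ y∈ → rest (All.lookup x# y∈)) (∑-0 xs)) ⟩
        suc k + 0              ≡⟨ +-identityʳ (suc k) ⟩
        suc k                  ≤⟨ subst (_≤ 1) fx≡ (f≤1 x) ⟩
        1                      ∎
      where
      open ≤-Reasoning
      rest : ∀ {n} → suc k ≡ 0 ⊎ n ≡ 0 → n ≡ 0
      rest (inj₂ eq) = eq

  ∑-map : ∀ {A B : Set} (f : B → ℕ) (g : A → B) xs → ∑ (map g xs) f ≡ ∑ xs (f ∘ g)
  ∑-map f g [] = refl
  ∑-map f g (x ∷ xs) = cong (f (g x) +_) (∑-map f g xs)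

  ∑-concatMap : ∀ {A B : Set} (f : B → ℕ) (g : A → List B) xs → ∑ (concatMap g xs) f ≡ ∑ xs (λ x → ∑ (g x) f)
  ∑-concatMap f g [] = refl
  ∑-concatMap f g (x ∷ xs) = trans (∑-++ f (g x) (concatMap g xs)) (cong (∑ (g x) f +_) (∑-concatMap f g xs))

  ∑-swap : ∀ {A B : Set} (f : A → B → ℕ) xs ys → ∑ xs (λ x → ∑ ys (f x)) ≡ ∑ ys (λ y → ∑ xs (λ x → f x y))
  ∑-swap f [] ys = sym (∑-0 ys)
  ∑-swap f (x ∷ xs) ys = trans (cong (∑ ys (f x) +_) (∑-swap f xs ys)) (sym (∑-+ (f x) (λ y → ∑ xs (λ x → f x y)) ys))

  oneTo-∷ʳ : ∀ n → oneTo (suc n) ≡ oneTo n ∷ʳ suc n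
  oneTo-∷ʳ n = trans (cong (map suc) (sym (upTo-∷ʳ n))) (map-++ suc (upTo n) (n ∷ []))

  -- Stated by bounds rather than with _/_, since these pass through the induction.
  count-multiples-bounds : ∀ d .{{_ : NonZero d}} n → let c = ∑ (oneTo n) (λ x → ⟦ d ∣? x ⟧) in c * d ≤ n × n < suc c * d
  count-multiples-bounds d zero = z≤n , subst (0 <_) (sym (+-identityʳ d)) (>-nonZero⁻¹ d)
  count-multiples-bounds d (suc n) =
    subst (λ c → c * d ≤ suc n × suc n < suc c * d)
      (sym (trans (cong (λ xs → ∑ xs (λ x → ⟦ d ∣? x ⟧)) (oneTo-∷ʳ n)) (∑-∷ʳ (λ x → ⟦ d ∣? x ⟧) (oneTo n) (suc n))))
      (step (∑ (oneTo n) (λ x → ⟦ d ∣? x ⟧)) (d ∣? suc n) (count-multiples-bounds d n))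
    where
    step : ∀ c (d∣? : Dec (d ∣ suc n)) → c * d ≤ n × n < suc c * d →
      (c + ⟦ d∣? ⟧) * d ≤ suc n × suc n < suc (c + ⟦ d∣? ⟧) * d
    step c (yes (divides e eq)) (lo , hi) rewrite +-comm c 1 =
      ≤-trans (*-monoˡ-≤ d (*-cancelʳ-< d c e (subst (c * d <_) eq (s≤s lo)))) (≤-reflexive (sym eq)) ,
      ≤-trans (s≤s hi) (+-monoˡ-≤ (suc c * d) (>-nonZero⁻¹ d))
    step c (no d∤) (lo , hi) rewrite +-identityʳ c =
      m≤n⇒m≤1+n lo , ≤∧≢⇒< hi λ eq → d∤ (divides (suc c) eq)

  count-multiples : ∀ d .{{_ : NonZero d}} n → ∑ (oneTo n) (λ x → ⟦ d ∣? x ⟧) ≡ n / d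
  count-multiples d n with lo , hi ← count-multiples-bounds d n = ≤-antisym
    (subst (_≤ n / d) (m*n/n≡m c d) (/-monoˡ-≤ d lo))
    (≤-pred (m<n*o⇒m/o<n hi))
    where c = ∑ (oneTo n) (λ x → ⟦ d ∣? x ⟧)

  betaP≡count : ∀ {p} → Prime p → ∀ n → betaP p n ≡ ∑ (oneTo n) (λ x → ⟦ primePart p n ∣? x ⟧)
  betaP≡count {zero} pp n = contradiction pp ¬prime[0]
  betaP≡count {suc q} pp n = sym (count-multiples (primePart (suc q) n) {{m^n≢0 (suc q) (gammaP (suc q) n)}} n)

  betaP≢0 : ∀ {p n} → Prime p → p ≤ n → betaP p n ≢ 0
  betaP≢0 {zero} pp p≤n = contradiction pp ¬prime[0]
  betaP≢0 {p@(suc q)} {n} pp p≤n eq = contradiction (m/n≡0⇒m<n eq) (≤⇒≯ (primePart≤n p (≤-trans (s≤s z≤n) p≤n)))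
    where instance _ = m^n≢0 p (gammaP p n)

  -- Since `n < p * primePart p n`, the quotient is always below `p`; for `p = 2` its only nonzero
  -- value is 1.
  betaP-2 : ∀ {n} → 2 ≤ n → betaP 2 n ≡ 1
  betaP-2 {n} 2≤n = ≤-antisym
    (≤-pred (m<n*o⇒m/o<n (n<p*primePart (s≤s (s≤s z≤n)) n)))
    (n≢0⇒n>0 (betaP≢0 prime[2] 2≤n))
    where instance _ = m^n≢0 2 (gammaP 2 n)

  -- Missing coupons of each class and the gain of a single draw.

  module Counts (n : ℕ) where

    primesRange : List ℕ
    primesRange = upTo (suc n)

    light? : ∀ p → Dec (Prime p × betaP p n ≡ 1)
    light? p = prime? p ×-dec (betaP p n ≟ 1)

    heavy? : ∀ p → Dec (Prime p × ¬ (betaP p n ≡ 1))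
    heavy? p = prime? p ×-dec ¬? (betaP p n ≟ 1)

    light heavy : ℕ → ℕ
    light p = ⟦ light? p ⟧
    heavy p = ⟦ heavy? p ⟧

    hit : ℕ → ℕ → ℕ
    hit p x = ⟦ primePart p n ∣? x ⟧

    miss : ℕ → List ℕ → ℕ
    miss p [] = 1
    miss p (x ∷ xs) = (1 ∸ hit p x) * miss p xs

    miss≤1 : ∀ p xs → miss p xs ≤ 1
    miss≤1 p [] = ≤-refl
    miss≤1 p (x ∷ xs) = *-mono-≤ (m∸n≤m 1 (hit p x)) (miss≤1 p xs)

    -- Additive form, which keeps truncated subtraction out of the sums built on it. The product
    -- `miss p xs * hit p x` marks the draw that collects `p` for the first time.
    miss-∷ʳ : ∀ p xs x → miss p (xs ∷ʳ x) + miss p xs * hit p x ≡ miss p xs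
    miss-∷ʳ p [] x with primePart p n ∣? x
    ... | yes _ = refl
    ... | no _ = refl
    miss-∷ʳ p (y ∷ xs) x with primePart p n ∣? y
    ... | yes _ = refl
    ... | no _ rewrite +-identityʳ (miss p (xs ∷ʳ x)) | +-identityʳ (miss p xs) = miss-∷ʳ p xs x

    miss≡0⇒Any : ∀ p xs → miss p xs ≡ 0 → Any (primePart p n ∣_) xs
    miss≡0⇒Any p (x ∷ xs) eq with primePart p n ∣? x
    ... | yes d = here d
    ... | no _ = there (miss≡0⇒Any p xs (trans (sym (+-identityʳ _)) eq))

    Any⇒miss≡0 : ∀ p xs → Any (primePart p n ∣_) xs → miss p xs ≡ 0
    Any⇒miss≡0 p (x ∷ xs) a with primePart p n ∣? x | a
    ... | yes _ | _ = refl
    ... | no ¬d | here d = contradiction d ¬d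
    ... | no _ | there a′ = trans (+-identityʳ _) (Any⇒miss≡0 p xs a′)

    missing : (ℕ → ℕ) → List ℕ → ℕ
    missing w xs = ∑ primesRange (λ p → w p * miss p xs)

    -- Number of primes of a class that the draw `x` collects for the first time; `w` is the
    -- indicator of the class, `light` or `heavy`.
    gain : (ℕ → ℕ) → List ℕ → ℕ → ℕ
    gain w xs x = ∑ primesRange (λ p → w p * (miss p xs * hit p x))

    missing-∷ʳ : ∀ w xs x → missing w (xs ∷ʳ x) + gain w xs x ≡ missing w xs
    missing-∷ʳ w xs x = trans
      (sym (∑-+ (λ p → w p * miss p (xs ∷ʳ x)) (λ p → w p * (miss p xs * hit p x)) primesRange))
      (∑-cong primesRange λ {p} _ → trans (sym (*-distribˡ-+ (w p) _ _)) (cong (w p *_) (miss-∷ʳ p xs x)))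

    -- Exchanging the two sums counts, for each missing `p`, the values of `x` that collect it, and
    -- there are `betaP p n` of them.
    ∑-gain : ∀ w xs → ∑ (oneTo n) (gain w xs) ≡ ∑ primesRange (λ p → w p * (miss p xs * ∑ (oneTo n) (hit p)))
    ∑-gain w xs = trans (∑-swap (λ x p → w p * (miss p xs * hit p x)) (oneTo n) primesRange)
      (∑-cong primesRange λ {p} _ → trans (∑-*ˡ (w p) (λ x → miss p xs * hit p x) (oneTo n))
        (cong (w p *_) (∑-*ˡ (miss p xs) (hit p) (oneTo n))))

    -- The equality matters: in the upper bound this sum is multiplied by `slope`, which can be
    -- negative. For heavy coupons an inequality suffices, because there the factor is `tail r ≥ 0`.
    ∑-gain-light : ∀ xs → ∑ (oneTo n) (gain light xs) ≡ missing light xs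
    ∑-gain-light xs = trans (∑-gain light xs) (∑-cong primesRange λ {p} _ → eq p)
      where
      eq : ∀ p → light p * (miss p xs * ∑ (oneTo n) (hit p)) ≡ light p * miss p xs
      eq p = aux (light? p)
        where
        aux : (l? : Dec (Prime p × betaP p n ≡ 1)) → ⟦ l? ⟧ * (miss p xs * ∑ (oneTo n) (hit p)) ≡ ⟦ l? ⟧ * miss p xs
        aux (no _) = refl
        aux (yes (pp , β≡1)) = cong (1 *_)
          (trans (cong (miss p xs *_) (trans (sym (betaP≡count pp n)) β≡1)) (*-identityʳ (miss p xs)))

    ∑-gain-heavy : ∀ xs → 2 * missing heavy xs ≤ ∑ (oneTo n) (gain heavy xs)
    ∑-gain-heavy xs = begin
      2 * missing heavy xs                                                   ≡⟨ ∑-*ˡ 2 (λ p → heavy p * miss p xs) primesRange ⟨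
      ∑ primesRange (λ p → 2 * (heavy p * miss p xs))                        ≤⟨ ∑-mono primesRange (λ {p} p∈ → le p (≤-pred (∈-upTo⁻ p∈)) (heavy? p)) ⟩
      ∑ primesRange (λ p → heavy p * (miss p xs * ∑ (oneTo n) (hit p)))      ≡⟨ ∑-gain heavy xs ⟨
      ∑ (oneTo n) (gain heavy xs)                                            ∎
      where
      open ≤-Reasoning
      le : ∀ p → p ≤ n → (h? : Dec (Prime p × ¬ (betaP p n ≡ 1))) → 2 * (⟦ h? ⟧ * miss p xs) ≤ ⟦ h? ⟧ * (miss p xs * ∑ (oneTo n) (hit p))
      le p p≤n (no _) = z≤n
      le p p≤n (yes (pp , β≢1)) rewrite +-identityʳ (miss p xs * ∑ (oneTo n) (hit p)) | +-identityʳ (miss p xs) | *-comm 2 (miss p xs) =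
        *-monoʳ-≤ (miss p xs) (subst (2 ≤_) (betaP≡count pp n) (≤∧≢⇒< (n≢0⇒n>0 (betaP≢0 pp p≤n)) (β≢1 ∘ sym)))

    light+heavy : ∀ p → light p + heavy p ≡ ⟦ prime? p ⟧
    light+heavy p = ⟦⟧-split (prime? p) (betaP p n ≟ 1)

    -- Merging the classes and bounding `miss` by 1 leaves the indicators of the primes whose prime
    -- part divides `x`. By `primePart-disjoint` no two of them are nonzero.
    gain≤1 : ∀ xs {x} → 1 ≤ x × x ≤ n → gain light xs x + gain heavy xs x ≤ 1
    gain≤1 xs {x} (1≤x , x≤n) = begin
      gain light xs x + gain heavy xs x                                         ≡⟨ ∑-+ (λ p → light p * (miss p xs * hit p x)) (λ p → heavy p * (miss p xs * hit p x)) primesRange ⟨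
      ∑ primesRange (λ p → light p * (miss p xs * hit p x) + heavy p * (miss p xs * hit p x))
                                                                                ≡⟨ ∑-cong primesRange (λ {p} _ → trans (sym (*-distribʳ-+ (miss p xs * hit p x) (light p) (heavy p))) (cong (_* (miss p xs * hit p x)) (light+heavy p))) ⟩
      ∑ primesRange (λ p → ⟦ prime? p ⟧ * (miss p xs * hit p x))                ≤⟨ ∑-mono primesRange (λ {p} _ → *-monoʳ-≤ ⟦ prime? p ⟧ (≤-trans (*-monoˡ-≤ (hit p x) (miss≤1 p xs)) (≤-reflexive (*-identityˡ (hit p x))))) ⟩
      ∑ primesRange (λ p → ⟦ prime? p ⟧ * hit p x)                              ≤⟨ ∑≤1 (λ p → *-mono-≤ (⟦⟧≤1 (prime? p)) (⟦⟧≤1 (primePart p n ∣? x))) pairs ⟩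
      1                                                                         ∎
      where
      open ≤-Reasoning
      disjoint : ∀ {p q} → p ≤ n → q ≤ n → p ≢ q →
        (pp? : Dec (Prime p)) (pq? : Dec (Prime q)) (dp? : Dec (primePart p n ∣ x)) (dq? : Dec (primePart q n ∣ x)) →
        ⟦ pp? ⟧ * ⟦ dp? ⟧ ≡ 0 ⊎ ⟦ pq? ⟧ * ⟦ dq? ⟧ ≡ 0
      disjoint p≤n q≤n p≢q (yes pp) (yes pq) (yes dp) (yes dq) =
        contradiction (primePart-disjoint pp pq p≤n q≤n 1≤x x≤n dp dq) p≢q
      disjoint p≤n q≤n p≢q (no _) _ _ _ = inj₁ refl
      disjoint p≤n q≤n p≢q (yes _) _ (no _) _ = inj₁ refl
      disjoint p≤n q≤n p≢q (yes _) (no _) (yes _) _ = inj₂ refl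
      disjoint p≤n q≤n p≢q (yes _) (yes _) (yes _) (no _) = inj₂ refl
      pairwise : ∀ {ps} → All (_≤ n) ps → Unique ps → AllPairs (λ p q → ⟦ prime? p ⟧ * hit p x ≡ 0 ⊎ ⟦ prime? q ⟧ * hit q x ≡ 0) ps
      pairwise [] [] = []
      pairwise (p≤n ∷ ps≤n) (p≢ ∷ u) =
        All.zipWith (λ {q} (q≤n , p≢q) → disjoint p≤n q≤n p≢q (prime? _) (prime? q) (primePart _ n ∣? x) (primePart q n ∣? x)) (ps≤n , p≢)
        ∷ pairwise ps≤n u
      pairs = pairwise (All.tabulate {xs = primesRange} (≤-pred ∘ ∈-upTo⁻)) (upTo⁺ (suc n))

    missing-light-[] : missing light [] ≡ omega1 n
    missing-light-[] = trans (∑-cong {g = light} primesRange (λ {p} _ → *-identityʳ (light p))) (sym (length-filter≡∑ light? primesRange))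

    omega1+missing-heavy-[] : omega1 n + missing heavy [] ≡ primeCount n
    omega1+missing-heavy-[] = begin
      omega1 n + missing heavy []                       ≡⟨ cong₂ _+_ (length-filter≡∑ light? primesRange) (∑-cong {g = heavy} primesRange (λ {p} _ → *-identityʳ (heavy p))) ⟩
      ∑ primesRange light + ∑ primesRange heavy         ≡⟨ ∑-+ light heavy primesRange ⟨
      ∑ primesRange (λ p → light p + heavy p)           ≡⟨ ∑-cong primesRange (λ {p} _ → light+heavy p) ⟩
      ∑ primesRange (λ p → ⟦ prime? p ⟧)                ≡⟨ length-filter≡∑ prime? primesRange ⟨
      primeCount n                                      ∎
      where open ≡-Reasoning

    missing-heavy-[] : missing heavy [] ≡ primeCount n ∸ omega1 n
    missing-heavy-[] = sym (trans (cong (_∸ omega1 n) (sym omega1+missing-heavy-[])) (m+n∸m≡n (omega1 n) (missing heavy [])))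

    omega1≢0 : 2 ≤ n → omega1 n ≢ 0
    omega1≢0 2≤n eq = contradiction
      (trans (sym (⟦⟧-yes (light? 2) (prime[2] , betaP-2 2≤n)))
        (∑-≡0 {f = light} primesRange (trans (sym (length-filter≡∑ light? primesRange)) eq) (∈-upTo⁺ (s≤s 2≤n))))
      λ ()

    complete⇒missing≡0 : ∀ xs → lcmList xs ≡ lcmUpTo n → missing light xs ≡ 0
    complete⇒missing≡0 xs eq = trans (∑-cong primesRange λ {p} p∈ → zero′ p (≤-pred (∈-upTo⁻ p∈)) (light? p)) (∑-0 primesRange)
      where
      zero′ : ∀ p → p ≤ n → (l? : Dec (Prime p × betaP p n ≡ 1)) → ⟦ l? ⟧ * miss p xs ≡ 0
      zero′ p p≤n (no _) = refl
      zero′ p p≤n (yes (pp , _)) = trans (+-identityʳ _) (Any⇒miss≡0 p xs (lcmList-collected eq pp p≤n))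

    missing≡0⇒complete : ∀ xs → All (λ x → 1 ≤ x × x ≤ n) xs → missing light xs + missing heavy xs ≡ 0 → lcmList xs ≡ lcmUpTo n
    missing≡0⇒complete xs inRange eq = lcmList-complete n xs inRange λ {p} pp p≤n →
      miss≡0⇒Any p xs (begin
        miss p xs                                         ≡⟨ *-identityˡ (miss p xs) ⟨
        1 * miss p xs                                     ≡⟨ cong (_* miss p xs) (trans (light+heavy p) (⟦⟧-yes (prime? p) pp)) ⟨
        (light p + heavy p) * miss p xs                   ≡⟨ *-distribʳ-+ (miss p xs) (light p) (heavy p) ⟩
        light p * miss p xs + heavy p * miss p xs         ≡⟨ ∑-≡0 {f = λ p → light p * miss p xs + heavy p * miss p xs} primesRange sum≡0 (∈-upTo⁺ (s≤s p≤n)) ⟩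
        0                                                 ∎)
      where
      open ≡-Reasoning
      sum≡0 : ∑ primesRange (λ p → light p * miss p xs + heavy p * miss p xs) ≡ 0
      sum≡0 = trans (∑-+ (λ p → light p * miss p xs) (λ p → heavy p * miss p xs) primesRange) eq

-- Rational arithmetic: embedding of ℕ, reciprocals and the sequence `tail`.

module Rationals where

  open import Data.Integer as ℤ using (+_; +[1+_])
  import Data.Integer.Properties as ℤ
  open import Data.Nat as ℕ using (ℕ; zero; suc; NonZero)
  import Data.Nat.Properties as ℕ
  open import Data.Rational hiding (NonZero)
  open import Data.Rational.Properties
  import Data.Rational.Unnormalised as ℚᵘ
  import Data.Rational.Unnormalised.Properties as ℚᵘ
  open import Data.Rational.Solver using (module +-*-Solver)
  open import Data.Product using (_,_; ∃)
  open import Relation.Binary.PropositionalEquality using (_≡_; refl; sym; trans; cong; cong₂; subst; module ≡-Reasoning)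
  open +-*-Solver using (solve; con; _:+_; _:*_; _:-_; _:=_)

  -- A quotient `+ a / suc d` is `fromℚᵘ` of an unnormalised fraction. Identities and inequalities
  -- are checked there by cross multiplication and then transported, which avoids the gcds of normal
  -- forms.
  fromℚᵘ-homo-+ : ∀ p q → fromℚᵘ (p ℚᵘ.+ q) ≡ fromℚᵘ p + fromℚᵘ q
  fromℚᵘ-homo-+ p q = toℚᵘ-injective (begin
    toℚᵘ (fromℚᵘ (p ℚᵘ.+ q))                   ≈⟨ toℚᵘ-fromℚᵘ (p ℚᵘ.+ q) ⟩
    p ℚᵘ.+ q                                   ≈⟨ ℚᵘ.+-cong (toℚᵘ-fromℚᵘ p) (toℚᵘ-fromℚᵘ q) ⟨
    toℚᵘ (fromℚᵘ p) ℚᵘ.+ toℚᵘ (fromℚᵘ q)       ≈⟨ toℚᵘ-homo-+ (fromℚᵘ p) (fromℚᵘ q) ⟨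
    toℚᵘ (fromℚᵘ p + fromℚᵘ q)                 ∎)
    where open ℚᵘ.≃-Reasoning

  fromℚᵘ-homo-* : ∀ p q → fromℚᵘ (p ℚᵘ.* q) ≡ fromℚᵘ p * fromℚᵘ q
  fromℚᵘ-homo-* p q = toℚᵘ-injective (begin
    toℚᵘ (fromℚᵘ (p ℚᵘ.* q))                   ≈⟨ toℚᵘ-fromℚᵘ (p ℚᵘ.* q) ⟩
    p ℚᵘ.* q                                   ≈⟨ ℚᵘ.*-cong (toℚᵘ-fromℚᵘ p) (toℚᵘ-fromℚᵘ q) ⟨
    toℚᵘ (fromℚᵘ p) ℚᵘ.* toℚᵘ (fromℚᵘ q)       ≈⟨ toℚᵘ-homo-* (fromℚᵘ p) (fromℚᵘ q) ⟨
    toℚᵘ (fromℚᵘ p * fromℚᵘ q)                 ∎)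
    where open ℚᵘ.≃-Reasoning

  fromℚᵘ-mono-≤ : ∀ {p q} → p ℚᵘ.≤ q → fromℚᵘ p ≤ fromℚᵘ q
  fromℚᵘ-mono-≤ {p} {q} p≤q = toℚᵘ-cancel-≤
    (ℚᵘ.≤-trans (ℚᵘ.≤-reflexive (toℚᵘ-fromℚᵘ p)) (ℚᵘ.≤-trans p≤q (ℚᵘ.≤-reflexive (ℚᵘ.≃-sym (toℚᵘ-fromℚᵘ q)))))

  toℚ-+ : ∀ a b → toℚ (a ℕ.+ b) ≡ toℚ a + toℚ b
  toℚ-+ a b = trans
    (fromℚᵘ-cong {ℚᵘ.mkℚᵘ (+ (a ℕ.+ b)) 0} {ℚᵘ.mkℚᵘ (+ a) 0 ℚᵘ.+ ℚᵘ.mkℚᵘ (+ b) 0}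
      (ℚᵘ.*≡* (cong (ℤ._* + 1) (cong₂ ℤ._+_ (sym (ℤ.*-identityʳ (+ a))) (sym (ℤ.*-identityʳ (+ b)))))))
    (fromℚᵘ-homo-+ (ℚᵘ.mkℚᵘ (+ a) 0) (ℚᵘ.mkℚᵘ (+ b) 0))

  toℚ-* : ∀ a b → toℚ (a ℕ.* b) ≡ toℚ a * toℚ b
  toℚ-* a b = trans
    (fromℚᵘ-cong {ℚᵘ.mkℚᵘ (+ (a ℕ.* b)) 0} {ℚᵘ.mkℚᵘ (+ a) 0 ℚᵘ.* ℚᵘ.mkℚᵘ (+ b) 0}
      (ℚᵘ.*≡* (cong (ℤ._* + 1) (ℤ.pos-* a b))))
    (fromℚᵘ-homo-* (ℚᵘ.mkℚᵘ (+ a) 0) (ℚᵘ.mkℚᵘ (+ b) 0))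

  /-mono-≤ : ∀ {a b} d .{{_ : NonZero d}} → a ℕ.≤ b → + a / d ≤ + b / d
  /-mono-≤ {a} {b} (suc d) a≤b = fromℚᵘ-mono-≤ {ℚᵘ.mkℚᵘ (+ a) d} {ℚᵘ.mkℚᵘ (+ b) d} (ℚᵘ.*≤* (ℤ.*-monoʳ-≤-nonNeg (+ suc d) (ℤ.+≤+ a≤b)))

  toℚ-mono-≤ : ∀ {a b} → a ℕ.≤ b → toℚ a ≤ toℚ b
  toℚ-mono-≤ = /-mono-≤ 1

  0≤toℚ : ∀ a → 0ℚ ≤ toℚ a
  0≤toℚ a = toℚ-mono-≤ {0} {a} ℕ.z≤n

  toℚ-suc : ∀ k → toℚ (suc k) ≡ 1ℚ + toℚ k
  toℚ-suc = toℚ-+ 1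

  recip : ∀ d .{{_ : NonZero d}} → ℚ
  recip d = + 1 / d

  /≡toℚ*recip : ∀ a d .{{_ : NonZero d}} → + a / d ≡ toℚ a * recip d
  /≡toℚ*recip a d@(suc d-1) = trans
    (fromℚᵘ-cong {ℚᵘ.mkℚᵘ (+ a) d-1} {ℚᵘ.mkℚᵘ (+ a) 0 ℚᵘ.* ℚᵘ.mkℚᵘ (+ 1) d-1}
      (ℚᵘ.*≡* (cong₂ ℤ._*_ (sym (ℤ.*-identityʳ (+ a))) (cong +_ (ℕ.+-identityʳ d)))))
    (fromℚᵘ-homo-* (ℚᵘ.mkℚᵘ (+ a) 0) (ℚᵘ.mkℚᵘ (+ 1) d-1))

  toℚ*recip : ∀ d .{{_ : NonZero d}} → toℚ d * recip d ≡ 1ℚ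
  toℚ*recip d@(suc d-1) = trans (sym (/≡toℚ*recip d d))
    (fromℚᵘ-cong {ℚᵘ.mkℚᵘ (+ d) d-1} {ℚᵘ.mkℚᵘ (+ 1) 0} (ℚᵘ.*≡* (ℤ.*-comm (+ d) (+ 1))))

  recip≥0 : ∀ d .{{_ : NonZero d}} → 0ℚ ≤ recip d
  recip≥0 d = subst (_≤ recip d) (0/n≡0 d) (/-mono-≤ {0} {1} d ℕ.z≤n)

  toℚ-pos : ∀ d .{{_ : NonZero d}} → Positive (toℚ d)
  toℚ-pos d = normalize-pos d 1

  *-monoˡ-≤ : ∀ {p q} r → 0ℚ ≤ r → p ≤ q → r * p ≤ r * q
  *-monoˡ-≤ r 0≤r = *-monoˡ-≤-nonNeg r {{nonNegative 0≤r}}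

  *-monoʳ-≤ : ∀ {p q} r → 0ℚ ≤ r → p ≤ q → p * r ≤ q * r
  *-monoʳ-≤ r 0≤r = *-monoʳ-≤-nonNeg r {{nonNegative 0≤r}}

  0≤* : ∀ {p q} → 0ℚ ≤ p → 0ℚ ≤ q → 0ℚ ≤ p * q
  0≤* {p} {q} 0≤p 0≤q = subst (_≤ p * q) (*-zeroʳ p) (*-monoˡ-≤ p 0≤p 0≤q)

  0≤p⇒q≤q+p : ∀ q {p} → 0ℚ ≤ p → q ≤ q + p
  0≤p⇒q≤q+p q {p} 0≤p = subst (_≤ q + p) (+-identityʳ q) (+-monoʳ-≤ q 0≤p)

  -- tail r = 1/((r+1)(r+2)); as a difference its first-step equation is linear.
  tail : ℕ → ℚ
  tail r = recip (suc r) - recip (suc (suc r))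

  -- The chance that r light coupons all precede a given coupon of weight 2 is 2 * tail r; balance is its first-step equation.
  tail-balance : ∀ s → toℚ (suc s) * (tail s - tail (suc s)) ≡ tail (suc s) + tail (suc s)
  tail-balance s = begin
    t * ((a - b) - (b - c))                          ≡⟨ solve 4 (λ t a b c → t :* ((a :- b) :- (b :- c)) :=
                                                          t :* a :- (con 1ℚ :+ t) :* b :- (con 1ℚ :+ t) :* b :+ (con 1ℚ :+ (con 1ℚ :+ t)) :* c :+ ((b :- c) :+ (b :- c))) refl t a b c ⟩
    t * a - (1ℚ + t) * b - (1ℚ + t) * b + (1ℚ + (1ℚ + t)) * c + ((b - c) + (b - c))
                                                     ≡⟨ cong (_+ ((b - c) + (b - c))) (cong₂ _+_ (cong₂ _-_ (cong₂ _-_ ta≡1 tb≡1) tb≡1) tc≡1) ⟩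
    1ℚ - 1ℚ - 1ℚ + 1ℚ + ((b - c) + (b - c))          ≡⟨ +-identityˡ _ ⟩
    (b - c) + (b - c)                                ∎
    where
    open ≡-Reasoning
    t = toℚ (suc s)
    a = recip (suc s)
    b = recip (suc (suc s))
    c = recip (suc (suc (suc s)))
    ta≡1 : t * a ≡ 1ℚ
    ta≡1 = toℚ*recip (suc s)
    tb≡1 : (1ℚ + t) * b ≡ 1ℚ
    tb≡1 = trans (cong (_* b) (sym (toℚ-suc (suc s)))) (toℚ*recip (suc (suc s)))
    tc≡1 : (1ℚ + (1ℚ + t)) * c ≡ 1ℚ
    tc≡1 = trans (cong (_* c) (trans (cong (λ x → 1ℚ + x) (sym (toℚ-suc (suc s)))) (sym (toℚ-suc (suc (suc s)))))) (toℚ*recip (suc (suc (suc s))))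

  recip-anti : ∀ s → recip (suc (suc s)) ≤ recip (suc s)
  recip-anti s = fromℚᵘ-mono-≤ {ℚᵘ.mkℚᵘ (+ 1) (suc s)} {ℚᵘ.mkℚᵘ (+ 1) s} (ℚᵘ.*≤* (ℤ.+≤+ (ℕ.+-monoˡ-≤ 0 (ℕ.n≤1+n (suc s)))))

  tail≡* : ∀ r → tail r ≡ recip (suc r) * recip (suc (suc r))
  tail≡* r = begin
    a - b                                ≡⟨ cong₂ _-_ (sym (*-identityʳ a)) (sym (*-identityˡ b)) ⟩
    a * 1ℚ - 1ℚ * b                      ≡⟨ cong₂ (λ x y → a * x - y * b) (sym tb≡1) (sym (toℚ*recip (suc r))) ⟩
    a * ((1ℚ + t) * b) - t * a * b       ≡⟨ solve 3 (λ t a b → a :* ((con 1ℚ :+ t) :* b) :- t :* a :* b := a :* b) refl t a b ⟩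
    a * b                                ∎
    where
    open ≡-Reasoning
    t = toℚ (suc r)
    a = recip (suc r)
    b = recip (suc (suc r))
    tb≡1 : (1ℚ + t) * b ≡ 1ℚ
    tb≡1 = trans (cong (_* b) (sym (toℚ-suc (suc r)))) (toℚ*recip (suc (suc r)))

  tail≥0 : ∀ r → 0ℚ ≤ tail r
  tail≥0 r = subst (0ℚ ≤_) (sym (tail≡* r)) (0≤* (recip≥0 (suc r)) (recip≥0 (suc (suc r))))

  recip-* : ∀ c d .{{_ : NonZero c}} .{{_ : NonZero d}} → recip c * recip d ≡ recip (c ℕ.* d) {{ℕ.m*n≢0 c d}}
  recip-* c@(suc c-1) d@(suc d-1) = sym (trans
    (fromℚᵘ-cong {ℚᵘ.mkℚᵘ (+ 1) (d-1 ℕ.+ c-1 ℕ.* d)} {ℚᵘ.mkℚᵘ (+ 1) c-1 ℚᵘ.* ℚᵘ.mkℚᵘ (+ 1) d-1} ℚᵘ.≃-refl)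
    (fromℚᵘ-homo-* (ℚᵘ.mkℚᵘ (+ 1) c-1) (ℚᵘ.mkℚᵘ (+ 1) d-1)))

  -- Source of the square in the theorem: for `r = suc s`, both 1/(r+1) and 1/(r+2) are at most 1/r.
  tail≤recip² : ∀ s → tail (suc s) ≤ recip (suc s ℕ.* suc s)
  tail≤recip² s = begin
    tail (suc s)                                          ≡⟨ tail≡* (suc s) ⟩
    recip (suc (suc s)) * recip (suc (suc (suc s)))       ≤⟨ *-monoʳ-≤ _ (recip≥0 (suc (suc (suc s)))) (recip-anti s) ⟩
    recip (suc s) * recip (suc (suc (suc s)))             ≤⟨ *-monoˡ-≤ _ (recip≥0 (suc s)) (≤-trans (recip-anti (suc s)) (recip-anti s)) ⟩
    recip (suc s) * recip (suc s)                         ≡⟨ recip-* (suc s) (suc s) ⟩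
    recip (suc s ℕ.* suc s)                               ∎
    where open ≤-Reasoning

  harmonic≤toℚ : ∀ r → harmonic r ≤ toℚ r
  harmonic≤toℚ zero = ≤-refl
  harmonic≤toℚ (suc r) = begin
    harmonic r + recip (suc r)    ≤⟨ +-mono-≤ (harmonic≤toℚ r) (recip≤1 r) ⟩
    toℚ r + 1ℚ                    ≡⟨ +-comm (toℚ r) 1ℚ ⟩
    1ℚ + toℚ r                    ≡⟨ toℚ-suc r ⟨
    toℚ (suc r)                   ∎
    where
    open ≤-Reasoning
    recip≤1 : ∀ s → recip (suc s) ≤ 1ℚ
    recip≤1 zero = ≤-refl
    recip≤1 (suc s) = ≤-trans (recip-anti s) (recip≤1 s)

  -- A positive fraction has numerator at least 1, so its own denominator serves.
  archimedean : ∀ ε → 0ℚ < ε → ∃ λ d → recip (suc d) ≤ ε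
  archimedean ε@(mkℚ +[1+ a ] d _) _ = d , subst (recip (suc d) ≤_) (fromℚᵘ-toℚᵘ ε) (/-mono-≤ {1} {suc a} (suc d) (ℕ.s≤s ℕ.z≤n))
  archimedean (mkℚ (+ 0) d _) (*<* (ℤ.+<+ ()))
  archimedean (mkℚ ℤ.-[1+ a ] d _) (*<* ())

-- Means over uniform sequences of fixed length.

module UniformDraws where

  open PrimeParts
  open Coupons
  open Rationals
  open import Data.Integer using (+_)
  open import Data.List using (List; []; _∷_; _∷ʳ_; map; length; filter; upTo)
  open import Data.List.Properties using (length-map; length-upTo)
  open import Data.List.Membership.Propositional using (_∈_)
  open import Data.List.Relation.Unary.All using (All; []; _∷_)
  open import Data.List.Relation.Unary.Any using (here; there)
  open import Data.Nat as ℕ using (ℕ; zero; suc; NonZero)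
  import Data.Nat.Properties as ℕ
  open import Data.Product using (_×_)
  open import Data.Rational hiding (NonZero)
  open import Data.Rational.Properties
  open import Data.Rational.Solver using (module +-*-Solver)
  open import Function using (_∘_)
  open import Relation.Binary.PropositionalEquality using (_≡_; refl; sym; trans; cong; cong₂; module ≡-Reasoning)
  open import Relation.Unary using (Decidable)
  open +-*-Solver using (solve; _:+_; _:*_; _:=_)

  ∑ᵠ : List ℕ → (ℕ → ℚ) → ℚ
  ∑ᵠ [] f = 0ℚ
  ∑ᵠ (x ∷ xs) f = f x + ∑ᵠ xs f

  ∑ᵠ-cong : ∀ {f g} xs → (∀ {x} → x ∈ xs → f x ≡ g x) → ∑ᵠ xs f ≡ ∑ᵠ xs g
  ∑ᵠ-cong [] _ = refl
  ∑ᵠ-cong (x ∷ xs) f≡g = cong₂ _+_ (f≡g (here refl)) (∑ᵠ-cong xs (f≡g ∘ there))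

  ∑ᵠ-mono : ∀ {f g} xs → (∀ {x} → x ∈ xs → f x ≤ g x) → ∑ᵠ xs f ≤ ∑ᵠ xs g
  ∑ᵠ-mono [] _ = ≤-refl
  ∑ᵠ-mono (x ∷ xs) f≤g = +-mono-≤ (f≤g (here refl)) (∑ᵠ-mono xs (f≤g ∘ there))

  ∑ᵠ≥0 : ∀ {f} xs → (∀ x → 0ℚ ≤ f x) → 0ℚ ≤ ∑ᵠ xs f
  ∑ᵠ≥0 [] _ = ≤-refl
  ∑ᵠ≥0 (x ∷ xs) 0≤f = +-mono-≤ (0≤f x) (∑ᵠ≥0 xs 0≤f)

  ∑ᵠ-+ : ∀ f g xs → ∑ᵠ xs (λ x → f x + g x) ≡ ∑ᵠ xs f + ∑ᵠ xs g
  ∑ᵠ-+ f g [] = refl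
  ∑ᵠ-+ f g (x ∷ xs) = trans (cong (_+_ (f x + g x)) (∑ᵠ-+ f g xs))
    (solve 4 (λ a b c d → a :+ b :+ (c :+ d) := a :+ c :+ (b :+ d)) refl (f x) (g x) (∑ᵠ xs f) (∑ᵠ xs g))

  ∑ᵠ-*ˡ : ∀ c f xs → ∑ᵠ xs (λ x → c * f x) ≡ c * ∑ᵠ xs f
  ∑ᵠ-*ˡ c f [] = sym (*-zeroʳ c)
  ∑ᵠ-*ˡ c f (x ∷ xs) = trans (cong (_+_ (c * f x)) (∑ᵠ-*ˡ c f xs)) (sym (*-distribˡ-+ c (f x) (∑ᵠ xs f)))

  ∑ᵠ-const : ∀ c xs → ∑ᵠ xs (λ _ → c) ≡ toℚ (length xs) * c
  ∑ᵠ-const c [] = sym (*-zeroˡ c)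
  ∑ᵠ-const c (x ∷ xs) = begin
    c + ∑ᵠ xs (λ _ → c)              ≡⟨ cong (_+_ c) (∑ᵠ-const c xs) ⟩
    c + toℚ (length xs) * c          ≡⟨ cong (_+ toℚ (length xs) * c) (*-identityˡ c) ⟨
    1ℚ * c + toℚ (length xs) * c     ≡⟨ *-distribʳ-+ c 1ℚ (toℚ (length xs)) ⟨
    (1ℚ + toℚ (length xs)) * c       ≡⟨ cong (_* c) (toℚ-suc (length xs)) ⟨
    toℚ (suc (length xs)) * c        ∎
    where open ≡-Reasoning

  toℚ-∑ : ∀ (f : ℕ → ℕ) xs → toℚ (∑ xs f) ≡ ∑ᵠ xs (toℚ ∘ f)
  toℚ-∑ f [] = refl
  toℚ-∑ f (x ∷ xs) = trans (toℚ-+ (f x) (∑ xs f)) (cong (_+_ (toℚ (f x))) (toℚ-∑ f xs))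

  length-oneTo : ∀ n → length (oneTo n) ≡ n
  length-oneTo n = trans (length-map suc (upTo n)) (length-upTo n)

  InRange : ℕ → ℕ → Set
  InRange n x = 1 ℕ.≤ x × x ℕ.≤ n

  module Mean (n : ℕ) {{_ : NonZero n}} where

    q : ℚ
    q = recip n

    n*q≡1 : toℚ n * q ≡ 1ℚ
    n*q≡1 = toℚ*recip n

    q*[n*_]≡ : ∀ c → q * (toℚ n * c) ≡ c
    q*[n*_]≡ c = trans (sym (*-assoc q (toℚ n) c)) (trans (cong (_* c) (trans (*-comm q (toℚ n)) n*q≡1)) (*-identityˡ c))

    avg : (ℕ → ℚ) → ℚ
    avg f = q * ∑ᵠ (oneTo n) f

    avg-const : ∀ c → avg (λ _ → c) ≡ c
    avg-const c = trans (cong (q *_) (trans (∑ᵠ-const c (oneTo n)) (cong (λ k → toℚ k * c) (length-oneTo n)))) (q*[n*_]≡ c)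

    -- Averages over the first draw outermost, matching the recursion of `seqs`; `𝔼-∷ʳ` isolates the
    -- last draw instead, as the step from time `k` to `k + 1` requires.
    𝔼 : ℕ → (List ℕ → ℚ) → ℚ
    𝔼 zero f = f []
    𝔼 (suc k) f = avg (λ x → 𝔼 k (λ xs → f (x ∷ xs)))

    𝔼-mono : ∀ k {f g} → (∀ xs → length xs ≡ k → All (InRange n) xs → f xs ≤ g xs) → 𝔼 k f ≤ 𝔼 k g
    𝔼-mono zero f≤g = f≤g [] refl []
    𝔼-mono (suc k) f≤g = *-monoˡ-≤ q (recip≥0 n) (∑ᵠ-mono (oneTo n) λ {x} x∈ →
      𝔼-mono k λ xs len inR → f≤g (x ∷ xs) (cong suc len) (∈oneTo⁻ x∈ ∷ inR))

    𝔼-cong : ∀ k {f g} → (∀ xs → length xs ≡ k → All (InRange n) xs → f xs ≡ g xs) → 𝔼 k f ≡ 𝔼 k g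
    𝔼-cong k f≡g = ≤-antisym
      (𝔼-mono k λ xs len inR → ≤-reflexive (f≡g xs len inR))
      (𝔼-mono k λ xs len inR → ≤-reflexive (sym (f≡g xs len inR)))

    𝔼-+ : ∀ k f g → 𝔼 k (λ xs → f xs + g xs) ≡ 𝔼 k f + 𝔼 k g
    𝔼-+ zero f g = refl
    𝔼-+ (suc k) f g = begin
      q * ∑ᵠ (oneTo n) (λ x → 𝔼 k (λ xs → f (x ∷ xs) + g (x ∷ xs)))
        ≡⟨ cong (q *_) (∑ᵠ-cong (oneTo n) λ {x} _ → 𝔼-+ k (f ∘ (x ∷_)) (g ∘ (x ∷_))) ⟩
      q * ∑ᵠ (oneTo n) (λ x → 𝔼 k (f ∘ (x ∷_)) + 𝔼 k (g ∘ (x ∷_)))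
        ≡⟨ cong (q *_) (∑ᵠ-+ (λ x → 𝔼 k (f ∘ (x ∷_))) (λ x → 𝔼 k (g ∘ (x ∷_))) (oneTo n)) ⟩
      q * (∑ᵠ (oneTo n) (λ x → 𝔼 k (f ∘ (x ∷_))) + ∑ᵠ (oneTo n) (λ x → 𝔼 k (g ∘ (x ∷_))))
        ≡⟨ *-distribˡ-+ q _ _ ⟩
      𝔼 (suc k) f + 𝔼 (suc k) g ∎
      where open ≡-Reasoning

    𝔼-*ˡ : ∀ k c f → 𝔼 k (λ xs → c * f xs) ≡ c * 𝔼 k f
    𝔼-*ˡ zero c f = refl
    𝔼-*ˡ (suc k) c f = begin
      q * ∑ᵠ (oneTo n) (λ x → 𝔼 k (λ xs → c * f (x ∷ xs)))
        ≡⟨ cong (q *_) (trans (∑ᵠ-cong (oneTo n) λ {x} _ → 𝔼-*ˡ k c (f ∘ (x ∷_))) (∑ᵠ-*ˡ c (λ x → 𝔼 k (f ∘ (x ∷_))) (oneTo n))) ⟩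
      q * (c * S)     ≡⟨ solve 3 (λ a b s → a :* (b :* s) := b :* (a :* s)) refl q c S ⟩
      c * (q * S)     ∎
      where
      open ≡-Reasoning
      S = ∑ᵠ (oneTo n) (λ x → 𝔼 k (f ∘ (x ∷_)))

    𝔼-∷ʳ : ∀ k f → 𝔼 (suc k) f ≡ 𝔼 k (λ xs → avg (λ x → f (xs ∷ʳ x)))
    𝔼-∷ʳ zero f = refl
    𝔼-∷ʳ (suc k) f = cong (q *_) (∑ᵠ-cong (oneTo n) λ {x} _ → 𝔼-∷ʳ k (f ∘ (x ∷_)))

    𝔼≥0 : ∀ k {f} → (∀ xs → 0ℚ ≤ f xs) → 0ℚ ≤ 𝔼 k f
    𝔼≥0 zero 0≤f = 0≤f []
    𝔼≥0 (suc k) 0≤f = 0≤* (recip≥0 n) (∑ᵠ≥0 (oneTo n) λ x → 𝔼≥0 k (0≤f ∘ (x ∷_)))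

    𝔼-step : ∀ k f g → 𝔼 (suc k) f + q * 𝔼 k g ≡ 𝔼 k (λ xs → q * (∑ᵠ (oneTo n) (λ x → f (xs ∷ʳ x)) + g xs))
    𝔼-step k f g = sym (begin
      𝔼 k (λ xs → q * (∑ᵠ (oneTo n) (λ x → f (xs ∷ʳ x)) + g xs))
        ≡⟨ 𝔼-cong k (λ xs _ _ → *-distribˡ-+ q _ (g xs)) ⟩
      𝔼 k (λ xs → avg (λ x → f (xs ∷ʳ x)) + q * g xs)
        ≡⟨ 𝔼-+ k (λ xs → avg (λ x → f (xs ∷ʳ x))) (λ xs → q * g xs) ⟩
      𝔼 k (λ xs → avg (λ x → f (xs ∷ʳ x))) + 𝔼 k (λ xs → q * g xs)
        ≡⟨ cong₂ _+_ (sym (𝔼-∷ʳ k f)) (𝔼-*ˡ k q g) ⟩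
      𝔼 (suc k) f + q * 𝔼 k g ∎)
      where open ≡-Reasoning

    -- A supermartingale step with compensator `g / n`. The hypothesis is multiplied by `n`, so that
    -- it speaks of a plain sum over the possible next draws.
    𝔼-drift-≤ : ∀ f g → (∀ xs → All (InRange n) xs → ∑ᵠ (oneTo n) (λ x → f (xs ∷ʳ x)) + g xs ≤ toℚ n * f xs) →
      ∀ k → 𝔼 (suc k) f + q * 𝔼 k g ≤ 𝔼 k f
    𝔼-drift-≤ f g drift k = begin
      𝔼 (suc k) f + q * 𝔼 k g                                         ≡⟨ 𝔼-step k f g ⟩
      𝔼 k (λ xs → q * (∑ᵠ (oneTo n) (λ x → f (xs ∷ʳ x)) + g xs))      ≤⟨ 𝔼-mono k (λ xs _ inR → *-monoˡ-≤ q (recip≥0 n) (drift xs inR)) ⟩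
      𝔼 k (λ xs → q * (toℚ n * f xs))                                 ≡⟨ 𝔼-cong k (λ xs _ _ → q*[n*_]≡ (f xs)) ⟩
      𝔼 k f                                                           ∎
      where open ≤-Reasoning

    𝔼-drift-≥ : ∀ f g → (∀ xs → All (InRange n) xs → toℚ n * f xs ≤ ∑ᵠ (oneTo n) (λ x → f (xs ∷ʳ x)) + g xs) →
      ∀ k → 𝔼 k f ≤ 𝔼 (suc k) f + q * 𝔼 k g
    𝔼-drift-≥ f g drift k = begin
      𝔼 k f                                                           ≡⟨ 𝔼-cong k (λ xs _ _ → q*[n*_]≡ (f xs)) ⟨
      𝔼 k (λ xs → q * (toℚ n * f xs))                                 ≤⟨ 𝔼-mono k (λ xs _ inR → *-monoˡ-≤ q (recip≥0 n) (drift xs inR)) ⟩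
      𝔼 k (λ xs → q * (∑ᵠ (oneTo n) (λ x → f (xs ∷ʳ x)) + g xs))      ≡⟨ 𝔼-step k f g ⟨
      𝔼 (suc k) f + q * 𝔼 k g                                         ∎
      where open ≤-Reasoning

    toℚ-∑-seqs : ∀ k (f : List ℕ → ℕ) → toℚ (∑ (seqs n k) f) ≡ toℚ (n ℕ.^ k) * 𝔼 k (toℚ ∘ f)
    toℚ-∑-seqs zero f = trans (cong toℚ (ℕ.+-identityʳ (f []))) (sym (*-identityˡ (toℚ (f []))))
    toℚ-∑-seqs (suc k) f = begin
      toℚ (∑ (seqs n (suc k)) f)
        ≡⟨ cong toℚ (∑-concatMap f (λ x → map (x ∷_) (seqs n k)) (oneTo n)) ⟩
      toℚ (∑ (oneTo n) (λ x → ∑ (map (x ∷_) (seqs n k)) f))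
        ≡⟨ toℚ-∑ (λ x → ∑ (map (x ∷_) (seqs n k)) f) (oneTo n) ⟩
      ∑ᵠ (oneTo n) (λ x → toℚ (∑ (map (x ∷_) (seqs n k)) f))
        ≡⟨ ∑ᵠ-cong (oneTo n) (λ {x} _ → trans (cong toℚ (∑-map f (x ∷_) (seqs n k))) (toℚ-∑-seqs k (f ∘ (x ∷_)))) ⟩
      ∑ᵠ (oneTo n) (λ x → toℚ (n ℕ.^ k) * 𝔼 k (toℚ ∘ f ∘ (x ∷_)))
        ≡⟨ ∑ᵠ-*ˡ (toℚ (n ℕ.^ k)) (λ x → 𝔼 k (toℚ ∘ f ∘ (x ∷_))) (oneTo n) ⟩
      toℚ (n ℕ.^ k) * S
        ≡⟨ cong (_* S) (trans (cong (_* toℚ (n ℕ.^ k)) n*q≡1) (*-identityˡ (toℚ (n ℕ.^ k)))) ⟨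
      toℚ n * q * toℚ (n ℕ.^ k) * S
        ≡⟨ solve 4 (λ a b c d → a :* b :* c :* d := a :* c :* (b :* d)) refl (toℚ n) q (toℚ (n ℕ.^ k)) S ⟩
      toℚ n * toℚ (n ℕ.^ k) * (q * S)
        ≡⟨ cong (_* (q * S)) (toℚ-* n (n ℕ.^ k)) ⟨
      toℚ (n ℕ.^ suc k) * 𝔼 (suc k) (toℚ ∘ f) ∎
      where
      open ≡-Reasoning
      S = ∑ᵠ (oneTo n) (λ x → 𝔼 k (toℚ ∘ f ∘ (x ∷_)))

    frequency≡𝔼 : ∀ {P : List ℕ → Set} (P? : Decidable P) k →
      (+ length (filter P? (seqs n k)) / (n ℕ.^ k)) {{ℕ.m^n≢0 n k}} ≡ 𝔼 k (λ xs → toℚ ⟦ P? xs ⟧)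
    frequency≡𝔼 P? k = begin
      + length (filter P? (seqs n k)) / (n ℕ.^ k)           ≡⟨ /≡toℚ*recip (length (filter P? (seqs n k))) (n ℕ.^ k) ⟩
      toℚ (length (filter P? (seqs n k))) * recip (n ℕ.^ k) ≡⟨ cong (λ c → toℚ c * recip (n ℕ.^ k)) (length-filter≡∑ P? (seqs n k)) ⟩
      toℚ (∑ (seqs n k) (λ xs → ⟦ P? xs ⟧)) * recip (n ℕ.^ k) ≡⟨ cong (_* recip (n ℕ.^ k)) (toℚ-∑-seqs k (λ xs → ⟦ P? xs ⟧)) ⟩
      toℚ (n ℕ.^ k) * e * recip (n ℕ.^ k)                   ≡⟨ solve 3 (λ a b c → a :* b :* c := a :* c :* b) refl (toℚ (n ℕ.^ k)) e (recip (n ℕ.^ k)) ⟩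
      toℚ (n ℕ.^ k) * recip (n ℕ.^ k) * e                   ≡⟨ cong (_* e) (toℚ*recip (n ℕ.^ k)) ⟩
      1ℚ * e                                                ≡⟨ *-identityˡ e ⟩
      e                                                     ∎
      where
      open ≡-Reasoning
      instance _ = ℕ.m^n≢0 n k
      e = 𝔼 k (λ xs → toℚ ⟦ P? xs ⟧)

-- Potentials of a state with `r` light and `j` heavy coupons missing.

module Potentials where

  open PrimeParts
  open Coupons
  open Rationals
  open UniformDraws
  open import Data.List using (List; []; _∷ʳ_; length)
  open import Data.List.Membership.Propositional using (_∈_)
  open import Data.List.Relation.Unary.All using (All; [])
  open import Data.Nat as ℕ using (ℕ; zero; suc; NonZero; z≤n; s≤s)
  import Data.Nat.Properties as ℕ
  open import Data.Rational hiding (NonZero)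
  open import Data.Rational.Properties
  open import Data.Rational.Solver using (module +-*-Solver)
  open import Function using (_∘_)
  open import Relation.Binary.PropositionalEquality using (_≡_; refl; sym; trans; cong; cong₂; module ≡-Reasoning)
  open import Relation.Nullary using (Dec; contradiction; ¬?)
  open +-*-Solver using (solve; con; _:+_; _:*_; _:-_; _:=_)

  -- Drop of `harmonic` from `r` to `r - 1`. The value at 0 is a default and only ever meets a
  -- factor 0.
  stepH : ℕ → ℚ
  stepH zero = 0ℚ
  stepH (suc s) = recip (suc s)

  -- Drop of `potential` when a light coupon is found and `j` stays fixed. It is negative for large
  -- `j`, since `tail` grows as `r` falls. The drop for a heavy coupon is `tail r`.
  slope : ℕ → ℕ → ℚ
  slope zero j = 0ℚ
  slope (suc s) j = recip (suc s) - toℚ j * (tail s - tail (suc s))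

  potential : ℕ → ℕ → ℚ
  potential r j = harmonic r + toℚ j * tail r

  -- The product `toℚ j * tail r` would produce a mixed term if both counts fell at once. As
  -- `ρ + η ≤ 1`, the drop is exactly linear in `ρ` and `η`.
  potential-diff : ∀ {r r′ j j′} ρ η → r′ ℕ.+ ρ ≡ r → j′ ℕ.+ η ≡ j → ρ ℕ.+ η ℕ.≤ 1 →
    potential r j ≡ potential r′ j′ + (toℚ ρ * slope r j + toℚ η * tail r)
  potential-diff {r} {r′} {j} {j′} 0 0 r≡ j≡ _ = trans
    (sym (cong₂ potential (trans (sym (ℕ.+-identityʳ r′)) r≡) (trans (sym (ℕ.+-identityʳ j′)) j≡)))
    (solve 3 (λ v a b → v := v :+ (con 0ℚ :* a :+ con 0ℚ :* b)) refl (potential r′ j′) (slope r j) (tail r))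
  potential-diff {r} {r′} {j} {j′} 1 0 r≡ j≡ _
    with refl ← trans (ℕ.+-comm 1 r′) r≡ | refl ← trans (sym (ℕ.+-identityʳ j′)) j≡ =
    solve 5 (λ h j t t′ c → h :+ c :+ j :* t′ := h :+ j :* t :+ (con 1ℚ :* (c :- j :* (t :- t′)) :+ con 0ℚ :* t′))
      refl (harmonic r′) (toℚ j) (tail r′) (tail (suc r′)) (recip (suc r′))
  potential-diff {r} {r′} {j} {j′} 0 1 r≡ j≡ _
    with refl ← trans (ℕ.+-comm 1 j′) j≡ | refl ← trans (sym (ℕ.+-identityʳ r′)) r≡ = trans
    (cong (λ x → harmonic r + x * tail r) (toℚ-suc j′))
    (solve 4 (λ h j t a → h :+ (con 1ℚ :+ j) :* t := h :+ j :* t :+ (con 0ℚ :* a :+ con 1ℚ :* t))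
      refl (harmonic r) (toℚ j′) (tail r) (slope r (suc j′)))
  potential-diff 1 (suc _) _ _ (s≤s ())
  potential-diff (suc (suc _)) _ _ _ (s≤s ())
  potential-diff 0 (suc (suc _)) _ _ (s≤s ())

  harmonic-diff : ∀ {r r′} ρ → r′ ℕ.+ ρ ≡ r → ρ ℕ.≤ 1 → harmonic r ≡ harmonic r′ + toℚ ρ * stepH r
  harmonic-diff {r} {r′} 0 r≡ _ = trans (sym (cong harmonic (trans (sym (ℕ.+-identityʳ r′)) r≡)))
    (sym (trans (cong (_+_ (harmonic r′)) (*-zeroˡ (stepH r))) (+-identityʳ (harmonic r′))))
  harmonic-diff {r} {r′} 1 r≡ _ with refl ← trans (ℕ.+-comm 1 r′) r≡ = cong (_+_ (harmonic r′)) (sym (*-identityˡ (recip (suc r′))))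
  harmonic-diff (suc (suc _)) _ (s≤s ())

  -- The core of the upper bound. For `r > 0`, `tail-balance` gives
  -- `r * slope r j = 1 - 2 * j * tail r`, and the heavy gain `h ≥ 2 * j` restores at least the
  -- amount subtracted. For `r = 0`, `tail 0 = 1/2` turns `h * tail 0` into at least `j`.
  slope-bound : ∀ r j h u → 2 ℕ.* j ℕ.≤ h → u ℕ.≤ 1 → u ℕ.≤ r ℕ.+ j →
    toℚ u ≤ toℚ r * slope r j + toℚ h * tail r
  slope-bound zero j h u 2j≤h _ u≤j = begin
    toℚ u                               ≤⟨ toℚ-mono-≤ u≤j ⟩
    toℚ j                               ≡⟨ solve 1 (λ x → x := con 0ℚ :* con 0ℚ :+ con (toℚ 2) :* x :* con (tail 0)) refl (toℚ j) ⟩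
    0ℚ * 0ℚ + toℚ 2 * toℚ j * tail 0    ≡⟨ cong (λ x → 0ℚ * 0ℚ + x * tail 0) (toℚ-* 2 j) ⟨
    0ℚ * 0ℚ + toℚ (2 ℕ.* j) * tail 0    ≤⟨ +-monoʳ-≤ (0ℚ * 0ℚ) (*-monoʳ-≤ (tail 0) (tail≥0 0) (toℚ-mono-≤ 2j≤h)) ⟩
    0ℚ * 0ℚ + toℚ h * tail 0            ∎
    where
    open ≤-Reasoning
  slope-bound (suc s) j h u 2j≤h u≤1 _ = begin
    toℚ u                                                 ≤⟨ toℚ-mono-≤ u≤1 ⟩
    1ℚ                                                    ≡⟨ solve 2 (λ j t → con 1ℚ := con 1ℚ :- j :* (t :+ t) :+ con (toℚ 2) :* j :* t) refl (toℚ j) t′ ⟩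
    1ℚ - toℚ j * (t′ + t′) + toℚ 2 * toℚ j * t′           ≡⟨ cong₂ (λ x y → x - toℚ j * y + toℚ 2 * toℚ j * t′) (sym (toℚ*recip (suc s))) (sym (tail-balance s)) ⟩
    T * c - toℚ j * (T * (tail s - t′)) + toℚ 2 * toℚ j * t′
                                                          ≡⟨ solve 5 (λ T c j d e → T :* c :- j :* (T :* d) :+ e := T :* (c :- j :* d) :+ e) refl T c (toℚ j) (tail s - t′) (toℚ 2 * toℚ j * t′) ⟩
    T * slope (suc s) j + toℚ 2 * toℚ j * t′              ≡⟨ cong (λ x → T * slope (suc s) j + x * t′) (toℚ-* 2 j) ⟨
    T * slope (suc s) j + toℚ (2 ℕ.* j) * t′              ≤⟨ +-monoʳ-≤ (T * slope (suc s) j) (*-monoʳ-≤ t′ (tail≥0 (suc s)) (toℚ-mono-≤ 2j≤h)) ⟩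
    T * slope (suc s) j + toℚ h * t′                      ∎
    where
    open ≤-Reasoning
    T = toℚ (suc s)
    c = recip (suc s)
    t′ = tail (suc s)

  ∑ᵠ-drift : ∀ n (f : ℕ → ℚ) (ρ η : ℕ → ℕ) A B c →
    (∀ {x} → x ∈ oneTo n → c ≡ f x + (toℚ (ρ x) * A + toℚ (η x) * B)) →
    toℚ n * c ≡ ∑ᵠ (oneTo n) f + (toℚ (∑ (oneTo n) ρ) * A + toℚ (∑ (oneTo n) η) * B)
  ∑ᵠ-drift n f ρ η A B c h = begin
    toℚ n * c                              ≡⟨ cong (λ k → toℚ k * c) (length-oneTo n) ⟨
    toℚ (length xs) * c                    ≡⟨ ∑ᵠ-const c xs ⟨
    ∑ᵠ xs (λ _ → c)                        ≡⟨ ∑ᵠ-cong xs h ⟩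
    ∑ᵠ xs (λ x → f x + (toℚ (ρ x) * A + toℚ (η x) * B))
                                           ≡⟨ ∑ᵠ-+ f (λ x → toℚ (ρ x) * A + toℚ (η x) * B) xs ⟩
    ∑ᵠ xs f + ∑ᵠ xs (λ x → toℚ (ρ x) * A + toℚ (η x) * B)
                                           ≡⟨ cong (_+_ (∑ᵠ xs f)) (∑ᵠ-+ (λ x → toℚ (ρ x) * A) (λ x → toℚ (η x) * B) xs) ⟩
    ∑ᵠ xs f + (∑ᵠ xs (λ x → toℚ (ρ x) * A) + ∑ᵠ xs (λ x → toℚ (η x) * B))
                                           ≡⟨ cong (_+_ (∑ᵠ xs f)) (cong₂ _+_ (pull ρ A) (pull η B)) ⟩
    ∑ᵠ xs f + (toℚ (∑ xs ρ) * A + toℚ (∑ xs η) * B) ∎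
    where
    open ≡-Reasoning
    xs = oneTo n
    pull : ∀ (ρ : ℕ → ℕ) A → ∑ᵠ xs (λ x → toℚ (ρ x) * A) ≡ toℚ (∑ xs ρ) * A
    pull ρ A = begin
      ∑ᵠ xs (λ x → toℚ (ρ x) * A)   ≡⟨ ∑ᵠ-cong xs (λ {x} _ → *-comm (toℚ (ρ x)) A) ⟩
      ∑ᵠ xs (λ x → A * toℚ (ρ x))   ≡⟨ ∑ᵠ-*ˡ A (toℚ ∘ ρ) xs ⟩
      A * ∑ᵠ xs (toℚ ∘ ρ)           ≡⟨ *-comm A _ ⟩
      ∑ᵠ xs (toℚ ∘ ρ) * A           ≡⟨ cong (_* A) (toℚ-∑ ρ xs) ⟨
      toℚ (∑ xs ρ) * A              ∎

  -- Drift along the draws and its telescoped form.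

  module Process (n : ℕ) {{_ : NonZero n}} where
    open Counts n
    open Mean n

    lights heavies : List ℕ → ℕ
    lights = missing light
    heavies = missing heavy

    complete? : ∀ xs → Dec (lcmList xs ≡ lcmUpTo n)
    complete? xs = lcmList xs ℕ.≟ lcmUpTo n

    unfinished : List ℕ → ℕ
    unfinished xs = ⟦ ¬? (complete? xs) ⟧

    unfinished≤missing : ∀ xs → All (InRange n) xs → unfinished xs ℕ.≤ lights xs ℕ.+ heavies xs
    unfinished≤missing xs inR with lights xs ℕ.+ heavies xs in eq
    ... | zero = ℕ.≤-reflexive (⟦⟧-no (¬? (complete? xs)) (λ ¬c → ¬c (missing≡0⇒complete xs inR eq)))
    ... | suc _ = ℕ.≤-trans (⟦⟧≤1 (¬? (complete? xs))) (s≤s z≤n)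

    V W D : List ℕ → ℚ
    V xs = potential (lights xs) (heavies xs)
    W xs = harmonic (lights xs)
    D xs = toℚ (lights xs ℕ.+ heavies xs)

    V-drift : ∀ xs → All (InRange n) xs → ∑ᵠ (oneTo n) (λ x → V (xs ∷ʳ x)) + toℚ (unfinished xs) ≤ toℚ n * V xs
    V-drift xs inR = begin
      S + toℚ (unfinished xs)                            ≤⟨ +-monoʳ-≤ S (slope-bound r j h (unfinished xs) (∑-gain-heavy xs) (⟦⟧≤1 (¬? (complete? xs))) (unfinished≤missing xs inR)) ⟩
      S + (toℚ r * slope r j + toℚ h * tail r)           ≡⟨ cong (λ k → S + (toℚ k * slope r j + toℚ h * tail r)) (∑-gain-light xs) ⟨
      S + (toℚ (∑ (oneTo n) (gain light xs)) * slope r j + toℚ h * tail r)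
                                                         ≡⟨ ∑ᵠ-drift n (λ x → V (xs ∷ʳ x)) (gain light xs) (gain heavy xs) (slope r j) (tail r) (V xs) each ⟨
      toℚ n * V xs                                       ∎
      where
      open ≤-Reasoning
      r = lights xs
      j = heavies xs
      h = ∑ (oneTo n) (gain heavy xs)
      S = ∑ᵠ (oneTo n) (λ x → V (xs ∷ʳ x))
      each : ∀ {x} → x ∈ oneTo n → V xs ≡ V (xs ∷ʳ x) + (toℚ (gain light xs x) * slope r j + toℚ (gain heavy xs x) * tail r)
      each {x} x∈ =
        potential-diff {r′ = lights (xs ∷ʳ x)} {j′ = heavies (xs ∷ʳ x)} (gain light xs x) (gain heavy xs x)
          (missing-∷ʳ light xs x) (missing-∷ʳ heavy xs x) (gain≤1 xs (∈oneTo⁻ x∈))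

    W-drift : ∀ xs → All (InRange n) xs → toℚ n * W xs ≤ ∑ᵠ (oneTo n) (λ x → W (xs ∷ʳ x)) + toℚ (unfinished xs)
    W-drift xs _ = begin
      toℚ n * W xs                                       ≡⟨ ∑ᵠ-drift n (λ x → W (xs ∷ʳ x)) (gain light xs) (λ _ → 0) (stepH r) 0ℚ (W xs) each ⟩
      S + (toℚ (∑ (oneTo n) (gain light xs)) * stepH r + toℚ (∑ (oneTo n) (λ _ → 0)) * 0ℚ)
                                                         ≡⟨ cong (_+_ S) (trans (cong₂ _+_ (cong (λ k → toℚ k * stepH r) (∑-gain-light xs)) (*-zeroʳ (toℚ (∑ (oneTo n) (λ _ → 0))))) (+-identityʳ (toℚ r * stepH r))) ⟩
      S + toℚ r * stepH r                                ≤⟨ +-monoʳ-≤ S (bound r refl) ⟩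
      S + toℚ (unfinished xs)                            ∎
      where
      open ≤-Reasoning
      r = lights xs
      S = ∑ᵠ (oneTo n) (λ x → W (xs ∷ʳ x))
      each : ∀ {x} → x ∈ oneTo n → W xs ≡ W (xs ∷ʳ x) + (toℚ (gain light xs x) * stepH r + 0ℚ * 0ℚ)
      each {x} x∈ =
        trans (harmonic-diff {r′ = lights (xs ∷ʳ x)} (gain light xs x) (missing-∷ʳ light xs x)
            (ℕ.m+n≤o⇒m≤o (gain light xs x) (gain≤1 xs (∈oneTo⁻ x∈))))
          (cong (_+_ (W (xs ∷ʳ x))) (sym (+-identityʳ (toℚ (gain light xs x) * stepH r))))
      -- The left side is 0 for `r = 0`. Otherwise it is 1, and a missing light coupon shows that
      -- the full lcm has not been reached.
      bound : ∀ r → lights xs ≡ r → toℚ r * stepH r ≤ toℚ (unfinished xs)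
      bound zero _ = 0≤toℚ (unfinished xs)
      bound (suc s) eq = ≤-reflexive (trans (toℚ*recip (suc s)) (cong toℚ (sym (⟦⟧-yes (¬? (complete? xs)) λ c →
        contradiction (trans (sym eq) (complete⇒missing≡0 xs c)) λ ()))))

    D-drift : ∀ xs → All (InRange n) xs → ∑ᵠ (oneTo n) (λ x → D (xs ∷ʳ x)) + D xs ≤ toℚ n * D xs
    D-drift xs _ = begin
      S + toℚ (lights xs ℕ.+ heavies xs)                        ≤⟨ +-monoʳ-≤ S (toℚ-mono-≤ (ℕ.+-mono-≤ (ℕ.≤-reflexive (sym (∑-gain-light xs))) (ℕ.≤-trans (ℕ.m≤m+n (heavies xs) _) (∑-gain-heavy xs)))) ⟩
      S + toℚ (∑ (oneTo n) (gain light xs) ℕ.+ ∑ (oneTo n) (gain heavy xs))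
                                                                ≡⟨ cong (_+_ S) (trans (toℚ-+ (∑ (oneTo n) (gain light xs)) (∑ (oneTo n) (gain heavy xs))) (sym (cong₂ _+_ (*-identityʳ (toℚ (∑ (oneTo n) (gain light xs)))) (*-identityʳ (toℚ (∑ (oneTo n) (gain heavy xs))))))) ⟩
      S + (toℚ (∑ (oneTo n) (gain light xs)) * 1ℚ + toℚ (∑ (oneTo n) (gain heavy xs)) * 1ℚ)
                                                                ≡⟨ ∑ᵠ-drift n (λ x → D (xs ∷ʳ x)) (gain light xs) (gain heavy xs) 1ℚ 1ℚ (D xs) each ⟨
      toℚ n * D xs                                              ∎
      where
      open ≤-Reasoning
      S = ∑ᵠ (oneTo n) (λ x → D (xs ∷ʳ x))
      each : ∀ {x} → x ∈ oneTo n → D xs ≡ D (xs ∷ʳ x) + (toℚ (gain light xs x) * 1ℚ + toℚ (gain heavy xs x) * 1ℚ)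
      each {x} _ = begin-equality
        toℚ (lights xs ℕ.+ heavies xs)                          ≡⟨ cong₂ (λ r j → toℚ (r ℕ.+ j)) (missing-∷ʳ light xs x) (missing-∷ʳ heavy xs x) ⟨
        toℚ (l ℕ.+ ρ ℕ.+ (h ℕ.+ η))                             ≡⟨ toℚ-+ (l ℕ.+ ρ) (h ℕ.+ η) ⟩
        toℚ (l ℕ.+ ρ) + toℚ (h ℕ.+ η)                           ≡⟨ cong₂ _+_ (toℚ-+ l ρ) (toℚ-+ h η) ⟩
        toℚ l + toℚ ρ + (toℚ h + toℚ η)                         ≡⟨ solve 4 (λ a b c d → a :+ b :+ (c :+ d) := a :+ c :+ (b :* con 1ℚ :+ d :* con 1ℚ)) refl (toℚ l) (toℚ ρ) (toℚ h) (toℚ η) ⟩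
        toℚ l + toℚ h + (toℚ ρ * 1ℚ + toℚ η * 1ℚ)               ≡⟨ cong (_+ (toℚ ρ * 1ℚ + toℚ η * 1ℚ)) (toℚ-+ l h) ⟨
        toℚ (l ℕ.+ h) + (toℚ ρ * 1ℚ + toℚ η * 1ℚ)               ∎
        where
        l = lights (xs ∷ʳ x)
        h = heavies (xs ∷ʳ x)
        ρ = gain light xs x
        η = gain heavy xs x

    -- This is P(T > k), because a full lcm stays full under further draws (`complete-∷ʳ`).
    surviving : ℕ → ℚ
    surviving k = 𝔼 k (toℚ ∘ unfinished)

    ∑surviving : ℕ → ℚ
    ∑surviving zero = 0ℚ
    ∑surviving (suc k) = ∑surviving k + surviving k

    -- Telescoped drift: each step costs at least `q` times its survival probability in mean
    -- potential, and the whole budget is `V []`.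
    V-bound : ∀ k → 𝔼 k V + q * ∑surviving k ≤ V []
    V-bound zero = ≤-reflexive (trans (cong (_+_ (V [])) (*-zeroʳ q)) (+-identityʳ (V [])))
    V-bound (suc k) = begin
      𝔼 (suc k) V + q * (∑surviving k + surviving k)        ≡⟨ solve 4 (λ e q s t → e :+ q :* (s :+ t) := e :+ q :* t :+ q :* s) refl (𝔼 (suc k) V) q (∑surviving k) (surviving k) ⟩
      𝔼 (suc k) V + q * surviving k + q * ∑surviving k      ≤⟨ +-monoˡ-≤ (q * ∑surviving k) (𝔼-drift-≤ V (toℚ ∘ unfinished) V-drift k) ⟩
      𝔼 k V + q * ∑surviving k                              ≤⟨ V-bound k ⟩
      V []                                                  ∎
      where
      open ≤-Reasoning

    W-bound : ∀ k → W [] ≤ 𝔼 k W + q * ∑surviving k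
    W-bound zero = ≤-reflexive (sym (trans (cong (_+_ (W [])) (*-zeroʳ q)) (+-identityʳ (W []))))
    W-bound (suc k) = begin
      W []                                                  ≤⟨ W-bound k ⟩
      𝔼 k W + q * ∑surviving k                              ≤⟨ +-monoˡ-≤ (q * ∑surviving k) (𝔼-drift-≥ W (toℚ ∘ unfinished) W-drift k) ⟩
      𝔼 (suc k) W + q * surviving k + q * ∑surviving k      ≡⟨ solve 4 (λ e q s t → e :+ q :* (s :+ t) := e :+ q :* t :+ q :* s) refl (𝔼 (suc k) W) q (∑surviving k) (surviving k) ⟨
      𝔼 (suc k) W + q * (∑surviving k + surviving k)        ∎
      where
      open ≤-Reasoning

-- From survival probabilities to the series for the expectation.

module StoppingTime where

  open PrimeParts
  open Coupons
  open Rationals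
  open UniformDraws
  open Potentials
  open import Data.List using (List; []; _∷_; _∷ʳ_; length; take)
  open import Data.List.Relation.Unary.All as All using (All; []; _∷_)
  import Data.List.Relation.Unary.All.Properties as All
  open import Data.List.Relation.Unary.Any as Any using ()
  import Data.List.Relation.Unary.Any.Properties as Any
  open import Data.Nat as ℕ using (ℕ; zero; suc; NonZero)
  open import Data.Nat.Divisibility using (_∣_; ∣-refl; ∣-antisym)
  import Data.Nat.Properties as ℕ
  open import Data.Product using (_,_; ∃; proj₁; proj₂)
  open import Data.Rational hiding (NonZero)
  open import Data.Rational.Properties
  open import Data.Rational.Solver using (module +-*-Solver)
  open import Function using (_∘_)
  open import Relation.Binary.PropositionalEquality using (_≡_; _≢_; refl; sym; trans; cong; cong₂; subst; subst₂; module ≡-Reasoning)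
  open import Relation.Nullary using (Dec; yes; no; contradiction; ¬?)
  open import Relation.Nullary.Decidable using (_×-dec_)
  open +-*-Solver using (solve; con; _:+_; _:*_; _:-_; _:=_)

  take-length-∷ʳ : ∀ {A : Set} {k} (xs : List A) x → length xs ≡ k → take k (xs ∷ʳ x) ≡ xs
  take-length-∷ʳ [] x refl = refl
  take-length-∷ʳ (y ∷ xs) x refl = cong (y ∷_) (take-length-∷ʳ xs x refl)

  -- A further draw can only enlarge the lcm in the divisibility order, and draws in range keep it a
  -- divisor of `lcmUpTo n`.
  complete-∷ʳ : ∀ {n xs x} → All (InRange n) xs → InRange n x → lcmList xs ≡ lcmUpTo n → lcmList (xs ∷ʳ x) ≡ lcmUpTo n
  complete-∷ʳ {n} {xs} {x} inR x∈R eq = ∣-antisym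
    (lcmList∣lcmUpTo (All.++⁺ inR (x∈R ∷ [])))
    (subst (_∣ lcmList (xs ∷ʳ x)) eq (lcmList-least {xs = xs} (All.tabulate λ y∈ →
      ∣lcmList (xs ∷ʳ x) (Any.map (λ { refl → ∣-refl }) (Any.++⁺ˡ y∈)))))

  -- With `Q` for completeness after `k` draws and `P` after `k + 1`, this is the split of the event
  -- T > k into T = k + 1 and T > k + 1.
  ⟦⟧-first : ∀ {a b} {P : Set a} {Q : Set b} (P? : Dec P) (Q? : Dec Q) → (Q → P) →
    ⟦ P? ×-dec ¬? Q? ⟧ ℕ.+ ⟦ ¬? P? ⟧ ≡ ⟦ ¬? Q? ⟧
  ⟦⟧-first (yes _) (yes _) _ = refl
  ⟦⟧-first (yes _) (no _) _ = refl
  ⟦⟧-first (no ¬p) (yes q) Q⇒P = contradiction (Q⇒P q) ¬p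
  ⟦⟧-first (no _) (no _) _ = refl

  probT≡𝔼 : ∀ n {{_ : NonZero n}} k → probT n k ≡ Mean.𝔼 n k (λ xs →
    toℚ ⟦ (lcmList xs ℕ.≟ lcmUpTo n) ×-dec ¬? (lcmList (take (k ℕ.∸ 1) xs) ℕ.≟ lcmUpTo n) ⟧)
  probT≡𝔼 n@(suc _) k = Mean.frequency≡𝔼 n
    (λ xs → (lcmList xs ℕ.≟ lcmUpTo n) ×-dec ¬? (lcmList (take (k ℕ.∸ 1) xs) ℕ.≟ lcmUpTo n)) k

  module Expectation (n : ℕ) {{_ : NonZero n}} where
    open Counts n
    open Mean n
    open Process n

    probT+surviving : ∀ k → probT n (suc k) + surviving (suc k) ≡ surviving k
    probT+surviving k = begin
      probT n (suc k) + surviving (suc k)                         ≡⟨ cong (_+ surviving (suc k)) (probT≡𝔼 n (suc k)) ⟩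
      𝔼 (suc k) (toℚ ∘ stops) + surviving (suc k)                 ≡⟨ 𝔼-+ (suc k) (toℚ ∘ stops) (toℚ ∘ unfinished) ⟨
      𝔼 (suc k) (λ xs → toℚ (stops xs) + toℚ (unfinished xs))     ≡⟨ 𝔼-∷ʳ k (λ xs → toℚ (stops xs) + toℚ (unfinished xs)) ⟩
      𝔼 k (λ xs → avg (λ x → toℚ (stops (xs ∷ʳ x)) + toℚ (unfinished (xs ∷ʳ x))))
                                                                  ≡⟨ 𝔼-cong k (λ xs len inR → trans (cong (q *_) (∑ᵠ-cong (oneTo n) (λ {x} x∈ → first xs x len inR (∈oneTo⁻ x∈)))) (avg-const (toℚ (unfinished xs)))) ⟩
      surviving k                                                 ∎
      where
      open ≡-Reasoning
      stops : List ℕ → ℕ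
      stops xs = ⟦ complete? xs ×-dec ¬? (complete? (take k xs)) ⟧
      first : ∀ xs x → length xs ≡ k → All (InRange n) xs → InRange n x →
        toℚ (stops (xs ∷ʳ x)) + toℚ (unfinished (xs ∷ʳ x)) ≡ toℚ (unfinished xs)
      first xs x len inR x∈R = begin
        toℚ (stops (xs ∷ʳ x)) + toℚ (unfinished (xs ∷ʳ x))
          ≡⟨ toℚ-+ (stops (xs ∷ʳ x)) (unfinished (xs ∷ʳ x)) ⟨
        toℚ (⟦ complete? (xs ∷ʳ x) ×-dec ¬? (complete? (take k (xs ∷ʳ x))) ⟧ ℕ.+ unfinished (xs ∷ʳ x))
          ≡⟨ cong (λ ys → toℚ (⟦ complete? (xs ∷ʳ x) ×-dec ¬? (complete? ys) ⟧ ℕ.+ unfinished (xs ∷ʳ x))) (take-length-∷ʳ xs x len) ⟩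
        toℚ (⟦ complete? (xs ∷ʳ x) ×-dec ¬? (complete? xs) ⟧ ℕ.+ unfinished (xs ∷ʳ x))
          ≡⟨ cong toℚ (⟦⟧-first (complete? (xs ∷ʳ x)) (complete? xs) (complete-∷ʳ inR x∈R)) ⟩
        toℚ (unfinished xs) ∎

    -- Summation by parts.
    expPartial+boundary : ∀ N → expPartial n N + toℚ N * surviving N ≡ ∑surviving N
    expPartial+boundary zero = trans (+-identityˡ (0ℚ * surviving 0)) (*-zeroˡ (surviving 0))
    expPartial+boundary (suc N) = begin
      e + toℚ (suc N) * p + toℚ (suc N) * s′      ≡⟨ solve 4 (λ e t p s → e :+ t :* p :+ t :* s := e :+ t :* (p :+ s)) refl e (toℚ (suc N)) p s′ ⟩
      e + toℚ (suc N) * (p + s′)                  ≡⟨ cong₂ (λ t x → e + t * x) (toℚ-suc N) (probT+surviving N) ⟩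
      e + (1ℚ + toℚ N) * s                        ≡⟨ solve 3 (λ e t s → e :+ (con 1ℚ :+ t) :* s := e :+ t :* s :+ s) refl e (toℚ N) s ⟩
      e + toℚ N * s + s                           ≡⟨ cong (_+ s) (expPartial+boundary N) ⟩
      ∑surviving N + s                            ∎
      where
      open ≡-Reasoning
      e = expPartial n N
      p = probT n (suc N)
      s = surviving N
      s′ = surviving (suc N)

    surviving≥0 : ∀ k → 0ℚ ≤ surviving k
    surviving≥0 k = 𝔼≥0 k (λ xs → 0≤toℚ (unfinished xs))

    n*[q*_]≡ : ∀ c → toℚ n * (q * c) ≡ c
    n*[q*_]≡ c = trans (sym (*-assoc (toℚ n) q c)) (trans (cong (_* c) n*q≡1) (*-identityˡ c))

    V≥0 : ∀ xs → 0ℚ ≤ V xs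
    V≥0 xs = +-mono-≤ (harmonic≥0 (lights xs)) (0≤* (0≤toℚ (heavies xs)) (tail≥0 (lights xs)))
      where
      harmonic≥0 : ∀ r → 0ℚ ≤ harmonic r
      harmonic≥0 zero = ≤-refl
      harmonic≥0 (suc r) = +-mono-≤ (harmonic≥0 r) (recip≥0 (suc r))

    -- The boundary term and the mean potential left at time `N` are both nonnegative and are
    -- dropped, so the bound holds for every partial sum.
    expPartial≤n*V : ∀ N → expPartial n N ≤ toℚ n * V []
    expPartial≤n*V N = begin
      expPartial n N                             ≤⟨ 0≤p⇒q≤q+p (expPartial n N) (0≤* (0≤toℚ N) (surviving≥0 N)) ⟩
      expPartial n N + toℚ N * surviving N       ≡⟨ expPartial+boundary N ⟩
      ∑surviving N                               ≡⟨ n*[q*_]≡ (∑surviving N) ⟨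
      toℚ n * (q * ∑surviving N)                 ≤⟨ *-monoˡ-≤ (toℚ n) (0≤toℚ n) q∑≤V ⟩
      toℚ n * V []                               ∎
      where
      open ≤-Reasoning
      q∑≤V : q * ∑surviving N ≤ V []
      q∑≤V = begin
        q * ∑surviving N              ≤⟨ 0≤p⇒q≤q+p (q * ∑surviving N) (𝔼≥0 N V≥0) ⟩
        q * ∑surviving N + 𝔼 N V      ≡⟨ +-comm (q * ∑surviving N) (𝔼 N V) ⟩
        𝔼 N V + q * ∑surviving N      ≤⟨ V-bound N ⟩
        V []                          ∎

    V[]-bound : 2 ℕ.≤ n → V [] ≤ harmonic (omega1 n) + (primeCount n ℕ.∸ omega1 n) /ℕ (omega1 n ℕ.* omega1 n)
    V[]-bound 2≤n = subst₂ (λ r j → potential r j ≤ harmonic (omega1 n) + (primeCount n ℕ.∸ omega1 n) /ℕ (omega1 n ℕ.* omega1 n))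
      (sym missing-light-[]) (sym missing-heavy-[]) (bound (omega1 n) (primeCount n ℕ.∸ omega1 n) (omega1≢0 2≤n))
      where
      open ≤-Reasoning
      bound : ∀ r j → r ≢ 0 → potential r j ≤ harmonic r + j /ℕ (r ℕ.* r)
      -- At `r = 0` the convention `a /ℕ 0 = 0` would make the bound false for `j > 0`, as
      -- `potential 0 j` is `j / 2`.
      bound zero j r≢0 = contradiction refl r≢0
      bound r@(suc s) j _ = +-monoʳ-≤ (harmonic r) (begin
        toℚ j * tail r             ≤⟨ *-monoˡ-≤ (toℚ j) (0≤toℚ j) (tail≤recip² s) ⟩
        toℚ j * recip (r ℕ.* r)    ≡⟨ /≡toℚ*recip j (r ℕ.* r) ⟨
        j /ℕ (r ℕ.* r)             ∎)

    upper-bound : 2 ℕ.≤ n → ∀ N → expPartial n N ≤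
      toℚ n * harmonic (omega1 n) + toℚ n * ((primeCount n ℕ.∸ omega1 n) /ℕ (omega1 n ℕ.* omega1 n))
    upper-bound 2≤n N = begin
      expPartial n N                     ≤⟨ expPartial≤n*V N ⟩
      toℚ n * V []                       ≤⟨ *-monoˡ-≤ (toℚ n) (0≤toℚ n) (V[]-bound 2≤n) ⟩
      toℚ n * (harmonic (omega1 n) + (primeCount n ℕ.∸ omega1 n) /ℕ (omega1 n ℕ.* omega1 n))
                                         ≡⟨ *-distribˡ-+ (toℚ n) (harmonic (omega1 n)) _ ⟩
      toℚ n * harmonic (omega1 n) + toℚ n * ((primeCount n ℕ.∸ omega1 n) /ℕ (omega1 n ℕ.* omega1 n)) ∎
      where open ≤-Reasoning

    -- Mean number of missing coupons. It dominates both errors of the lower bound: the mean of `W`,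
    -- as `harmonic r ≤ r`, and P(T > k), by Markov's inequality.
    uncollected : ℕ → ℚ
    uncollected k = 𝔼 k D

    uncollected≥0 : ∀ k → 0ℚ ≤ uncollected k
    uncollected≥0 k = 𝔼≥0 k (λ xs → 0≤toℚ (lights xs ℕ.+ heavies xs))

    uncollected-step : ∀ k → uncollected (suc k) + q * uncollected k ≤ uncollected k
    uncollected-step = 𝔼-drift-≤ D D D-drift

    uncollected-anti : ∀ k → uncollected (suc k) ≤ uncollected k
    uncollected-anti k = ≤-trans (0≤p⇒q≤q+p (uncollected (suc k)) (0≤* (recip≥0 n) (uncollected≥0 k))) (uncollected-step k)

    -- Bernoulli's inequality (1 - 1/n)^k ≤ n/(n+k), without the powers.
    uncollected-decay : ∀ K k → (toℚ n + toℚ k) * uncollected (k ℕ.+ K) ≤ toℚ n * uncollected K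
    uncollected-decay K zero = ≤-reflexive (cong (_* uncollected K) (+-identityʳ (toℚ n)))
    uncollected-decay K (suc k) = begin
      (toℚ n + toℚ (suc k)) * d′                                 ≡⟨ cong (λ t → (toℚ n + t) * d′) (toℚ-suc k) ⟩
      (toℚ n + (1ℚ + toℚ k)) * d′                                ≡⟨ solve 3 (λ n k d → (n :+ (con 1ℚ :+ k)) :* d := n :* d :+ d :+ k :* d) refl (toℚ n) (toℚ k) d′ ⟩
      toℚ n * d′ + d′ + toℚ k * d′                               ≤⟨ +-mono-≤ (+-monoʳ-≤ (toℚ n * d′) (uncollected-anti (k ℕ.+ K))) (*-monoˡ-≤ (toℚ k) (0≤toℚ k) (uncollected-anti (k ℕ.+ K))) ⟩
      toℚ n * d′ + d + toℚ k * d                                 ≡⟨ cong (λ x → toℚ n * d′ + x + toℚ k * d) (n*[q*_]≡ d) ⟨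
      toℚ n * d′ + toℚ n * (q * d) + toℚ k * d                   ≡⟨ cong (_+ toℚ k * d) (*-distribˡ-+ (toℚ n) d′ (q * d)) ⟨
      toℚ n * (d′ + q * d) + toℚ k * d                           ≤⟨ +-monoˡ-≤ (toℚ k * d) (*-monoˡ-≤ (toℚ n) (0≤toℚ n) (uncollected-step (k ℕ.+ K))) ⟩
      toℚ n * d + toℚ k * d                                      ≡⟨ *-distribʳ-+ d (toℚ n) (toℚ k) ⟨
      (toℚ n + toℚ k) * d                                        ≤⟨ uncollected-decay K k ⟩
      toℚ n * uncollected K                                      ∎
      where
      open ≤-Reasoning
      d = uncollected (k ℕ.+ K)
      d′ = uncollected (suc k ℕ.+ K)

    -- Here the leftover terms have the wrong sign. The residue `n * 𝔼 N W` and the boundary term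
    -- `N * surviving N` are both charged to `uncollected N`.
    n*harmonic≤ : ∀ N → toℚ n * harmonic (omega1 n) ≤ expPartial n N + (toℚ n + toℚ N) * uncollected N
    n*harmonic≤ N = begin
      toℚ n * harmonic (omega1 n)                                     ≡⟨ cong (λ r → toℚ n * harmonic r) missing-light-[] ⟨
      toℚ n * W []                                                    ≤⟨ *-monoˡ-≤ (toℚ n) (0≤toℚ n) (W-bound N) ⟩
      toℚ n * (𝔼 N W + q * ∑surviving N)                              ≡⟨ trans (*-distribˡ-+ (toℚ n) (𝔼 N W) (q * ∑surviving N)) (cong (_+_ (toℚ n * 𝔼 N W)) (n*[q*_]≡ (∑surviving N))) ⟩
      toℚ n * 𝔼 N W + ∑surviving N                                    ≡⟨ cong (_+_ (toℚ n * 𝔼 N W)) (expPartial+boundary N) ⟨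
      toℚ n * 𝔼 N W + (expPartial n N + toℚ N * surviving N)          ≤⟨ +-mono-≤ (*-monoˡ-≤ (toℚ n) (0≤toℚ n) W≤) (+-monoʳ-≤ (expPartial n N) (*-monoˡ-≤ (toℚ N) (0≤toℚ N) surviving≤)) ⟩
      toℚ n * uncollected N + (expPartial n N + toℚ N * uncollected N) ≡⟨ solve 4 (λ n u e k → n :* u :+ (e :+ k :* u) := e :+ (n :+ k) :* u) refl (toℚ n) (uncollected N) (expPartial n N) (toℚ N) ⟩
      expPartial n N + (toℚ n + toℚ N) * uncollected N                ∎
      where
      open ≤-Reasoning
      W≤ : 𝔼 N W ≤ uncollected N
      W≤ = 𝔼-mono N λ xs _ _ → ≤-trans (harmonic≤toℚ (lights xs)) (toℚ-mono-≤ (ℕ.m≤m+n (lights xs) (heavies xs)))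
      surviving≤ : surviving N ≤ uncollected N
      surviving≤ = 𝔼-mono N λ xs _ inR → toℚ-mono-≤ (unfinished≤missing xs inR)

    -- Started at 0, `uncollected-decay` only keeps the left side bounded. Restarted at `M` it
    -- leaves a multiple of `uncollected M`, which does tend to 0.
    boundary-decay : ∀ M → (toℚ n + toℚ (M ℕ.+ M)) * uncollected (M ℕ.+ M) ≤ toℚ (2 ℕ.* n) * uncollected M
    boundary-decay M = begin
      (toℚ n + toℚ (M ℕ.+ M)) * u                           ≡⟨ cong (λ t → (toℚ n + t) * u) (toℚ-+ M M) ⟩
      -- One more `n * u` completes `n + 2 * M` to `2 * (n + M)`, the factor that the decay from `M`
      -- to `M + M` controls.
      (toℚ n + (toℚ M + toℚ M)) * u                         ≤⟨ 0≤p⇒q≤q+p _ (0≤* (0≤toℚ n) (uncollected≥0 (M ℕ.+ M))) ⟩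
      (toℚ n + (toℚ M + toℚ M)) * u + toℚ n * u             ≡⟨ solve 3 (λ n m u → (n :+ (m :+ m)) :* u :+ n :* u := con (toℚ 2) :* ((n :+ m) :* u)) refl (toℚ n) (toℚ M) u ⟩
      toℚ 2 * ((toℚ n + toℚ M) * u)                         ≤⟨ *-monoˡ-≤ (toℚ 2) (0≤toℚ 2) (uncollected-decay M M) ⟩
      toℚ 2 * (toℚ n * uncollected M)                       ≡⟨ *-assoc (toℚ 2) (toℚ n) (uncollected M) ⟨
      toℚ 2 * toℚ n * uncollected M                         ≡⟨ cong (_* uncollected M) (toℚ-* 2 n) ⟨
      toℚ (2 ℕ.* n) * uncollected M                         ∎
      where
      open ≤-Reasoning
      u = uncollected (M ℕ.+ M)

    -- With M = 2ndc and c > n D₀, the decay M u ≤ n D₀ forces 2ndu ≤ 1.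
    uncollected-small : ∀ d .{{_ : NonZero d}} → ∃ λ M → toℚ (2 ℕ.* n) * uncollected M ≤ recip d
    uncollected-small d = M , *-cancelʳ-≤-pos (toℚ d) {{toℚ-pos d}} (begin
      toℚ (2 ℕ.* n) * u * toℚ d      ≤⟨ *-cancelʳ-≤-pos (toℚ c) {{toℚ-pos c}} scaled ⟩
      1ℚ                             ≡⟨ trans (*-comm (recip d) (toℚ d)) (toℚ*recip d) ⟨
      recip d * toℚ d                ∎)
      where
      open ≤-Reasoning
      D₀ = lights [] ℕ.+ heavies []
      c = suc (n ℕ.* D₀)
      M = 2 ℕ.* n ℕ.* d ℕ.* c
      u = uncollected M
      decay : (toℚ n + toℚ M) * u ≤ toℚ n * D []
      decay = subst (λ k → (toℚ n + toℚ M) * uncollected k ≤ toℚ n * D []) (ℕ.+-identityʳ M) (uncollected-decay 0 M)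
      scaled : toℚ (2 ℕ.* n) * u * toℚ d * toℚ c ≤ 1ℚ * toℚ c
      scaled = begin
        toℚ (2 ℕ.* n) * u * toℚ d * toℚ c          ≡⟨ solve 4 (λ a u d c → a :* u :* d :* c := a :* d :* c :* u) refl (toℚ (2 ℕ.* n)) u (toℚ d) (toℚ c) ⟩
        toℚ (2 ℕ.* n) * toℚ d * toℚ c * u          ≡⟨ cong (_* u) (trans (toℚ-* (2 ℕ.* n ℕ.* d) c) (cong (_* toℚ c) (toℚ-* (2 ℕ.* n) d))) ⟨
        toℚ M * u                                  ≤⟨ 0≤p⇒q≤q+p (toℚ M * u) (0≤* (0≤toℚ n) (uncollected≥0 M)) ⟩
        toℚ M * u + toℚ n * u                      ≡⟨ solve 3 (λ m n u → m :* u :+ n :* u := (n :+ m) :* u) refl (toℚ M) (toℚ n) u ⟩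
        (toℚ n + toℚ M) * u                        ≤⟨ decay ⟩
        toℚ n * toℚ D₀                             ≡⟨ toℚ-* n D₀ ⟨
        toℚ (n ℕ.* D₀)                             ≤⟨ toℚ-mono-≤ (ℕ.n≤1+n (n ℕ.* D₀)) ⟩
        toℚ c                                      ≡⟨ *-identityˡ (toℚ c) ⟨
        1ℚ * toℚ c                                 ∎

    lower-bound : ∀ ε → 0ℚ < ε → ∃ λ N → toℚ n * harmonic (omega1 n) - ε ≤ expPartial n N
    -- `M` is chosen so that `2 * n * uncollected M` is at most a unit fraction below `ε`; doubling
    -- it lets `boundary-decay` bound the whole error.
    lower-bound ε 0<ε = M ℕ.+ M , (begin
      h - ε                                                     ≤⟨ +-monoˡ-≤ (- ε) (n*harmonic≤ (M ℕ.+ M)) ⟩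
      e + (toℚ n + toℚ (M ℕ.+ M)) * uncollected (M ℕ.+ M) - ε   ≤⟨ +-monoˡ-≤ (- ε) (+-monoʳ-≤ e (≤-trans (boundary-decay M) (≤-trans (proj₂ small) (proj₂ below-ε)))) ⟩
      e + ε - ε                                                 ≡⟨ solve 2 (λ e x → e :+ x :- x := e) refl e ε ⟩
      e                                                         ∎)
      where
      open ≤-Reasoning
      below-ε = archimedean ε 0<ε
      small = uncollected-small (suc (proj₁ below-ε))
      M = proj₁ small
      h = toℚ n * harmonic (omega1 n)
      e = expPartial n (M ℕ.+ M)

open StoppingTime
open import Data.Nat using (ℕ; _≤_; _∸_; _*_; >-nonZero)
open import Data.Nat.Properties using (≤-trans; n≤1+n)
open import Data.Rational using (ℚ; 0ℚ; _+_; _-_; _<_) renaming (_*_ to _*ℚ_; _≤_ to _≤ℚ_)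
open import Data.Product using (_×_; ∃; _,_)

theorem6p6 : (n : ℕ) → 2 ≤ n →
    ((ε : ℚ) → 0ℚ < ε →
    ∃ λ N → toℚ n *ℚ harmonic (omega1 n) - ε ≤ℚ expPartial n N)
    ×
    ((N : ℕ) → expPartial n N ≤ℚ
    toℚ n *ℚ harmonic (omega1 n)
    + toℚ n *ℚ ((primeCount n ∸ omega1 n) /ℕ (omega1 n * omega1 n)))
theorem6p6 n 2≤n = lower-bound , upper-bound 2≤n
  where
  instance _ = >-nonZero (≤-trans (n≤1+n 1) 2≤n)
  open Expectation n
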